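{- Let $\Xi_M$ be the set of inconsistency pairs defined in the context. (1) For all sets $A,B,C$: $A\perp^{\Xi_M}_CB$ if and only if $\operatorname{acl}(AD)\cap B\subseteq\operatorname{acl}D$ for every set $D$ such that $C\subseteq D\subseteq BC$. (2) $\Xi_M$ is transitive and normal. (3) $A\perp^{M}_CB$ implies $A\perp^{\Xi_M}_CB$. (4) $\perp^{\text{þ}}=\perp^{M*}=\perp^{\Xi_M*}$.
   Context: $T$ is a complete consistent first-order theory (possibly many-sorted); we work in a big saturated model of $T$. All sets are small subsets of the big model; $BC$ means $B\cup C$; $\operatorname{acl}$ is algebraic closure. A tuple also denotes the set of its entries, and $\bar a\in A$ means that all entries of $\bar a$ lie in $A$. $A\equiv_BA'$ means that some automorphism fixing $B$ pointwise maps the set $A$ onto $A'$. For a ternary relation $\perp$, the relation $\perp^*$ is defined by: $A\perp^*_CB$ iff for all $\hat B\supseteq B$ there is $A'\equiv_{BC}A$ such that $A'\perp_C\hat B$. M-dividing independence: $A\perp^M_CB$ iff $\operatorname{acl}(AC')\cap\operatorname{acl}(BC')=\operatorname{acl}C'$ for every $C'$ with $C\subseteq C'\subseteq\operatorname{acl}(BC)$. Thorn-forking independence $\perp^{\text{þ}}$ is defined as $\perp^{M*}$. Inconsistency pairs: for a formula $\varphi(\bar x;\bar y)$ whose free variables are partitioned into two blocks, a parameter-free formula $\psi(\bar y_0,\dots,\bar y_{k-1})$ (also written $\psi(\bar y_{<k})$) is a $k$-inconsistency witness for $\varphi(\bar x;\bar y)$ if $\big(\bigwedge_{i<k}\varphi(\bar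 x;\bar y_i)\big)\wedge\psi(\bar y_{<k})$ is inconsistent. $\Xi$ is the set of all pairs $(\varphi,\psi)$ such that, for some $k<\omega$, $\psi$ is a $k$-inconsistency witness for $\varphi$. $\Xi_M$ is the set of all pairs $(\varphi(\bar x;u\bar v),\psi((u\bar v)_{<k}))\in\Xi$ such that $u$ is a single variable, $\bar v$ is a tuple of variables, and $\psi((u\bar v)_{<k})$ is the formula $\bigwedge_{i<j<k}(u_i\neq u_j\wedge\bar v_i=\bar v_j)$. (The position of the distinguished variable $u$ within the right-hand block is immaterial, and formulas $\psi$ of this form are identified when they differ only by trivial rewriting of the conjunction.) For $(\varphi,\psi)\in\Xi$, a formula $\varphi(\bar x;\bar b)$ $(\varphi,\psi)$-divides over $C$ if there is a sequence $(\bar b_i)_{i<\omega}$ such that each $\bar b_i$ realises $\operatorname{tp}(\bar b/C)$ and $\models\psi(\bar b_{i_0},\dots,\bar b_{i_{k-1}})$ for all $i_0<\dots<i_{k-1}<\omega$. For $\Omega\subseteq\Xi$, a partial type $\Omega$-divides over $C$ if for some $(\varphi,\psi)\in\Omega$ it contains a formula $\varphi(\bar x;\bar b)$ that $(\varphi,\psi)$-divides over $C$. Define $A\perp^{\Omega}_CB$ iff there is no $\bar a\in A$ such that $\operatorname{tp}(\bar a/BC)$ $\Omega$-divides over $C$. - $\Omega$ is transitive if: whenever $(\varphi(\bar y;\bar x),\psi(\bar x_{<k}))\in\Omega$, $D\subseteq C$, $C\perp^\Omega_D\bar a$ and $\varphi(\bar y;\bar a)$ $(\varphi,\psi)$-divides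 over $D$, then $\varphi(\bar y;\bar a)$ $(\varphi,\psi)$-divides over $C$. - $\Omega$ is normal if: whenever $(\varphi(\bar x,\bar z;\bar y),\psi(\bar y_{<k}))\in\Omega$, then also $(\varphi(\bar x;\bar z,\bar y),\psi'(\bar y_{<k},\bar z_{<k}))\in\Omega$, where $\psi'$ is $\psi(\bar y_{<k})\wedge(\bar z_0=\bar z_1=\dots=\bar z_{k-1})$. -}

module Defs where

open import Data.Fin as Fin using (Fin)
open import Data.List using (List; []; _∷_; _++_; [_]; map; foldr; filter; allFin; cartesianProduct)
open import Data.List.Membership.Propositional using (_∈_)
open import Data.List.Membership.Propositional.Properties using (∈-++⁺ˡ; ∈-++⁺ʳ; ∈-++⁻)
open import Data.List.Relation.Binary.BagAndSetEquality using (_∼[_]_; set)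
open import Data.List.Relation.Unary.All as All using (All; []; _∷_)
open import Data.List.Relation.Unary.Any using (here; there)
open import Data.Nat as ℕ using (ℕ)
open import Data.Product using (Σ; Σ-syntax; ∃; ∃-syntax; _×_; _,_)
open import Data.Sum as Sum using (_⊎_; inj₁; inj₂; [_,_]′)
open import Data.Unit.Polymorphic using (⊤)
open import Function using (_∘_; _⇔_)
open import Level using (Level; suc)
open import Relation.Binary.PropositionalEquality using (_≡_; refl)
open import Relation.Nullary using (¬_)
open import Relation.Unary using (Pred; ｛_｝; _∪_; _∩_; _⊆_; _≐_)

private
  variable
    ℓ : Level

record Signature ℓ : Set (suc ℓ) where
  field
    Sort : Set ℓ
    Fun  : List Sort → Sort → Set ℓ
    Rel  : List Sort → Set ℓ

module Syntax {ℓ} (L : Signature ℓ) where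
  open Signature L public

  -- Γ s is the set of variables (or constants for parameters) of sort s.
  -- Γ ∪ Δ is the disjoint union of Γ and Δ, and ｛ s ｝ consists of one
  -- variable, of sort s.
  Ctx : Set (suc ℓ)
  Ctx = Pred Sort ℓ

  -- Finite tuples of variables are given by the list of their sorts.
  Var : List Sort → Ctx
  Var X s = s ∈ X

  data Term (Γ : Ctx) : Sort → Set ℓ where
    var : ∀ {s} → Γ s → Term Γ s
    fun : ∀ {ss s} → Fun ss s → All (Term Γ) ss → Term Γ s

  infixr 6 _∧̇_
  infix  7 _≈̇_

  -- The remaining connectives are classically definable.
  data Formula (Γ : Ctx) : Set ℓ where
    _≈̇_ : ∀ {s} → Term Γ s → Term Γ s → Formula Γ
    rel : ∀ {ss} → Rel ss → All (Term Γ) ss → Formula Γ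
    ⊤̇   : Formula Γ
    ¬̇_  : Formula Γ → Formula Γ
    _∧̇_ : Formula Γ → Formula Γ → Formula Γ
    ∃̇   : ∀ s → Formula (Γ ∪ ｛ s ｝) → Formula Γ

  Sentence : Set ℓ
  Sentence = Formula (Var [])

  module _ {Γ Δ : Ctx} (ρ : Γ ⊆ Δ) where
    mutual
      renameᵗ : ∀ {s} → Term Γ s → Term Δ s
      renameᵗ (var v)    = var (ρ v)
      renameᵗ (fun f ts) = fun f (rename* ts)

      rename* : ∀ {ss} → All (Term Γ) ss → All (Term Δ) ss
      rename* []       = []
      rename* (t ∷ ts) = renameᵗ t ∷ rename* ts

  rename : ∀ {Γ Δ : Ctx} → Γ ⊆ Δ → Formula Γ → Formula Δ
  rename ρ (t ≈̇ u)    = renameᵗ ρ t ≈̇ renameᵗ ρ u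
  rename ρ (rel R ts) = rel R (rename* ρ ts)
  rename ρ ⊤̇          = ⊤̇
  rename ρ (¬̇ φ)      = ¬̇ rename ρ φ
  rename ρ (φ ∧̇ ψ)    = rename ρ φ ∧̇ rename ρ ψ
  rename ρ (∃̇ s φ)    = ∃̇ s (rename (Sum.map₁ ρ) φ)

  ⋀ : ∀ {Γ} → List (Formula Γ) → Formula Γ
  ⋀ = foldr _∧̇_ ⊤̇

  conjuncts : ∀ {Γ} → Formula Γ → List (Formula Γ)
  conjuncts ⊤̇       = []
  conjuncts (φ ∧̇ ψ) = conjuncts φ ++ conjuncts ψ
  conjuncts φ       = [ φ ]

  -- φ ≃ ψ: the formulas agree up to bracketing, order, repetitions and
  -- trivial members of conjunctions.
  infix 4 _≃_
  _≃_ : ∀ {Γ} → Formula Γ → Formula Γ → Set ℓ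
  φ ≃ ψ = conjuncts φ ∼[ set ] conjuncts ψ

  -- equal Z x y is x̄ = ȳ.
  equal : ∀ {Γ} Z (x y : Var Z ⊆ Γ) → Formula Γ
  equal []      x y = ⊤̇
  equal (_ ∷ Z) x y =
    var (x (here refl)) ≈̇ var (y (here refl)) ∧̇ equal Z (x ∘ there) (y ∘ there)

  -- differOnlyAt u x y says that x̄ and ȳ differ at the position u and
  -- agree at all the others.
  differOnlyAt : ∀ {Γ Y s} → Var Y s → (x y : Var Y ⊆ Γ) → Formula Γ
  differOnlyAt {Y = _ ∷ Y} (here _) x y =
    (¬̇ (var (x (here refl)) ≈̇ var (y (here refl)))) ∧̇ equal Y (x ∘ there) (y ∘ there)
  differOnlyAt (there u) x y =
    var (x (here refl)) ≈̇ var (y (here refl)) ∧̇ differOnlyAt u (x ∘ there) (y ∘ there)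

  -- The variables of ȳ₀, …, ȳₖ₋₁.
  Copies : ℕ → List Sort → Ctx
  Copies k Y s = Fin k × Var Y s

  pairs : ∀ k → List (Fin k × Fin k)
  pairs k = filter (λ (i , j) → i Fin.<? j) (cartesianProduct (allFin k) (allFin k))

  ⋀[_<_] : ∀ {Γ} k → (Fin k → Fin k → Formula Γ) → Formula Γ
  ⋀[_<_] k χ = ⋀ (map (λ (i , j) → χ i j) (pairs k))

-- Following the usual convention, all sorts are non-empty.
record Structure (L : Signature ℓ) : Set (suc (suc ℓ)) where
  open Signature L
  field
    Carrier  : Sort → Set (suc ℓ)
    nonempty : ∀ s → Carrier s
    fun⟦_⟧   : ∀ {ss s} → Fun ss s → All Carrier ss → Carrier s
    rel⟦_⟧   : ∀ {ss} → Rel ss → Pred (All Carrier ss) (suc ℓ)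

module Semantics {ℓ} {L : Signature ℓ} (M : Structure L) where
  open Syntax L
  open Structure M

  Env : Ctx → Set (suc ℓ)
  Env Γ = Γ ⊆ Carrier

  infixr 5 _⊕_
  _⊕_ : ∀ {Γ Δ : Ctx} → Env Γ → Env Δ → Env (Γ ∪ Δ)
  (a ⊕ b) = [ a , b ]′

  single : ∀ {s} → Carrier s → Env ｛ s ｝
  single a refl = a

  mutual
    ⟦_⟧ᵗ : ∀ {Γ s} → Term Γ s → Env Γ → Carrier s
    ⟦ var v ⟧ᵗ    e = e v
    ⟦ fun f ts ⟧ᵗ e = fun⟦ f ⟧ (⟦ ts ⟧* e)

    ⟦_⟧* : ∀ {Γ ss} → All (Term Γ) ss → Env Γ → All Carrier ss
    ⟦ [] ⟧*     e = []
    ⟦ t ∷ ts ⟧* e = ⟦ t ⟧ᵗ e ∷ ⟦ ts ⟧* e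

  infix 4 ⊨_⟨_⟩
  ⊨_⟨_⟩ : ∀ {Γ} → Formula Γ → Env Γ → Set (suc ℓ)
  ⊨ t ≈̇ u    ⟨ e ⟩ = ⟦ t ⟧ᵗ e ≡ ⟦ u ⟧ᵗ e
  ⊨ rel R ts ⟨ e ⟩ = rel⟦ R ⟧ (⟦ ts ⟧* e)
  ⊨ ⊤̇        ⟨ e ⟩ = ⊤
  ⊨ ¬̇ φ      ⟨ e ⟩ = ¬ (⊨ φ ⟨ e ⟩)
  ⊨ φ ∧̇ ψ    ⟨ e ⟩ = ⊨ φ ⟨ e ⟩ × ⊨ ψ ⟨ e ⟩
  ⊨ ∃̇ s φ    ⟨ e ⟩ = Σ[ a ∈ Carrier s ] (⊨ φ ⟨ (λ {t} → _⊕_ {Δ = ｛ s ｝} e (single a) {t}) ⟩)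

  ⊨ˢ_ : Sentence → Set (suc ℓ)
  ⊨ˢ σ = ⊨ σ ⟨ (λ ()) ⟩

Theory : Signature ℓ → Set (suc (suc ℓ))
Theory {ℓ} L = Pred (Syntax.Sentence L) (suc ℓ)

Model : {L : Signature ℓ} → Theory L → Pred (Structure L) (suc ℓ)
Model T M = ∀ σ → T σ → Semantics.⊨ˢ_ M σ

infix 4 _⊩_
_⊩_ : {L : Signature ℓ} → Theory L → Syntax.Sentence L → Set (suc (suc ℓ))
T ⊩ σ = ∀ M → Model T M → Semantics.⊨ˢ_ M σ

Consistent : {L : Signature ℓ} → Theory L → Set (suc (suc ℓ))
Consistent T = ∃ (Model T)

Complete : {L : Signature ℓ} → Theory L → Set (suc (suc ℓ))
Complete {L = L} T = ∀ (σ : Syntax.Sentence L) → T ⊩ σ ⊎ T ⊩ Syntax.¬̇_ σ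

-- Structures live in Set (suc ℓ); a subset is small if it
-- is the image of a family indexed by types in Set ℓ.

module BigModel {ℓ} {L : Signature ℓ} (M : Structure L) where
  open Syntax L public
  open Structure M public
  open Semantics M public

  Element : Set (suc ℓ)
  Element = ∃ Carrier

  Subset : Set (suc (suc ℓ))
  Subset = Pred Element (suc ℓ)

  record SmallSet : Set (suc ℓ) where
    constructor small
    field
      Index : Ctx
      elem  : Env Index
  open SmallSet public

  ⟪_⟫ : SmallSet → Subset
  ⟪ A ⟫ (s , a) = Σ[ i ∈ Index A s ] elem A i ≡ a

  infixl 6 _⋓_
  _⋓_ : SmallSet → SmallSet → SmallSet
  A ⋓ B = small (Index A ∪ Index B) (λ {s} → _⊕_ {Index A} {Index B} (elem A) (elem B) {s})

  Tuple : List Sort → Set (suc ℓ)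
  Tuple X = Env (Var X)

  entries : ∀ {X} → Tuple X → SmallSet
  entries {X} a = small (Var X) a

  -- Formulas with free variables Γ and parameters from A.
  FormulaOver : SmallSet → Ctx → Set ℓ
  FormulaOver A Γ = Formula (Γ ∪ Index A)

  infix 4 ⊨[_]_⟨_⟩
  ⊨[_]_⟨_⟩ : ∀ {Γ} A → FormulaOver A Γ → Env Γ → Set (suc ℓ)
  ⊨[_]_⟨_⟩ {Γ} A χ e = ⊨ χ ⟨ (λ {s} → _⊕_ {Γ} {Index A} e (elem A) {s}) ⟩

  tp : ∀ {X} → Tuple X → (B : SmallSet) → Pred (FormulaOver B (Var X)) (suc ℓ)
  tp a B χ = ⊨[ B ] χ ⟨ a ⟩

  acl : SmallSet → Subset
  acl A (s , a) = Σ[ χ ∈ FormulaOver A ｛ s ｝ ] (⊨[ A ] χ ⟨ single a ⟩) ×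
    (∃[ as ] (∀ a′ → ⊨[ A ] χ ⟨ single a′ ⟩ → a′ ∈ as))

  record Automorphism : Set (suc ℓ) where
    field
      to       : ∀ {s} → Carrier s → Carrier s
      from     : ∀ {s} → Carrier s → Carrier s
      to-from  : ∀ {s} (a : Carrier s) → to (from a) ≡ a
      from-to  : ∀ {s} (a : Carrier s) → from (to a) ≡ a
      to-fun   : ∀ {ss s} (f : Fun ss s) as → to (fun⟦ f ⟧ as) ≡ fun⟦ f ⟧ (All.map to as)
      to-rel   : ∀ {ss} (R : Rel ss) as → rel⟦ R ⟧ as ⇔ rel⟦ R ⟧ (All.map to as)
  open Automorphism public

  -- A ≡[ B ] A′ is A ≡_B A′.
  infix 4 _≡[_]_
  _≡[_]_ : SmallSet → SmallSet → SmallSet → Set (suc ℓ)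
  A ≡[ B ] A′ = Σ[ σ ∈ Automorphism ]
    (∀ {s} {b : Carrier s} → ⟪ B ⟫ (s , b) → to σ b ≡ b) ×
    (⟪ small (Index A) (λ i → to σ (elem A i)) ⟫ ≐ ⟪ A′ ⟫)

  Saturated : Set (suc (suc ℓ))
  Saturated = ∀ (A : SmallSet) s (p : Pred (FormulaOver A ｛ s ｝) (suc ℓ)) →
    (∀ χs → All p χs → ∃[ a ] All (λ χ → ⊨[ A ] χ ⟨ single a ⟩) χs) →
    ∃[ a ] (∀ χ → p χ → ⊨[ A ] χ ⟨ single a ⟩)

  StronglyHomogeneous : Set (suc ℓ)
  StronglyHomogeneous = ∀ (I : Ctx) (a b : Env I) →
    (∀ (χ : Formula I) → ⊨ χ ⟨ a ⟩ → ⊨ χ ⟨ b ⟩) →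
    Σ[ σ ∈ Automorphism ] (∀ {s} (i : I s) → to σ (a i) ≡ b i)

  IsBig : Set (suc (suc ℓ))
  IsBig = Saturated × StronglyHomogeneous

  -- R A C B stands for A ⊥_C B.

  Ternary : Set (suc (suc ℓ))
  Ternary = SmallSet → SmallSet → SmallSet → Set (suc ℓ)

  _* : Ternary → Ternary
  (R *) A C B = ∀ B̂ → ⟪ B ⟫ ⊆ ⟪ B̂ ⟫ → Σ[ A′ ∈ SmallSet ] (A′ ≡[ B ⋓ C ] A) × R A′ C B̂

  ⊥M : Ternary
  ⊥M A C B = ∀ C′ → ⟪ C ⟫ ⊆ ⟪ C′ ⟫ → ⟪ C′ ⟫ ⊆ acl (B ⋓ C) →
    (acl (A ⋓ C′) ∩ acl (B ⋓ C′)) ≐ acl C′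

  ⊥þ : Ternary
  ⊥þ = ⊥M *

  -- φ(x̄;ȳ) together with ψ(ȳ₀,…,ȳₖ₋₁).
  record FormulaPair : Set ℓ where
    constructor pair
    field
      {X Y} : List Sort
      k     : ℕ
      φ     : Formula (Var X ∪ Var Y)
      ψ     : Formula (Copies k Y)

  Inconsistent : ∀ {Γ} → Formula Γ → Set (suc ℓ)
  Inconsistent {Γ} χ = ¬ (Σ[ e ∈ Env Γ ] ⊨ χ ⟨ e ⟩)

  Ξ : Pred FormulaPair (suc ℓ)
  Ξ (pair {X} {Y} k φ ψ) = Inconsistent {Var X ∪ Copies k Y}
    (⋀ (map (λ i → rename (Sum.map₂ (i ,_)) φ) (allFin k)) ∧̇ rename inj₂ ψ)

  -- The position u of the distinguished variable is arbitrary; v̄ consists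
  -- of the variables at the other positions.
  ΞM : Pred FormulaPair (suc ℓ)
  ΞM P@(pair {Y = Y} k φ ψ) = Ξ P ×
    (∃[ s ] Σ[ u ∈ Var Y s ] ψ ≃ ⋀[ k <_] (λ i j → differOnlyAt u (i ,_) (j ,_)))

  Divides : (P : FormulaPair) → Tuple (FormulaPair.Y P) → SmallSet → Set (suc ℓ)
  Divides (pair {X} {Y} k φ ψ) b C = Σ[ bs ∈ (ℕ → Tuple Y) ]
    (∀ i χ → tp b C χ → tp (bs i) C χ) ×
    (∀ (ι : Fin k → ℕ) → (∀ i j → i Fin.< j → ι i ℕ.< ι j) →
      ⊨ ψ ⟨ (λ (i , y) → bs (ι i) y) ⟩)

  PartialType : List Sort → SmallSet → Set (suc (suc ℓ))
  PartialType X B = Pred (FormulaOver B (Var X)) (suc ℓ)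

  -- The formula φ(x̄;b̄) over B, for b̄ ∈ B.
  instantiate : ∀ {X Y B} → Formula (Var X ∪ Var Y) → Var Y ⊆ Index B → FormulaOver B (Var X)
  instantiate φ b = rename (Sum.map₂ b) φ

  TypeDivides : Pred FormulaPair (suc ℓ) → ∀ {X B} → PartialType X B → SmallSet → Set (suc ℓ)
  TypeDivides Ω {X} {B} p C =
    Σ[ Y ∈ List Sort ] Σ[ k ∈ ℕ ] Σ[ φ ∈ Formula (Var X ∪ Var Y) ] Σ[ ψ ∈ Formula (Copies k Y) ]
    Σ[ b ∈ Var Y ⊆ Index B ]
      Ω (pair k φ ψ) × p (instantiate {B = B} φ b) × Divides (pair k φ ψ) (λ y → elem B (b y)) C

  ⊥[_] : Pred FormulaPair (suc ℓ) → Ternary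
  ⊥[ Ω ] A C B = ¬ (Σ[ X ∈ List Sort ] Σ[ a ∈ Tuple X ]
    ⟪ entries a ⟫ ⊆ ⟪ A ⟫ × TypeDivides Ω {B = B ⋓ C} (tp a (B ⋓ C)) C)

  Transitive : Pred FormulaPair (suc ℓ) → Set (suc ℓ)
  Transitive Ω = ∀ P → Ω P → ∀ (a : Tuple (FormulaPair.Y P)) C D →
    ⟪ D ⟫ ⊆ ⟪ C ⟫ → ⊥[ Ω ] C D (entries a) → Divides P a D → Divides P a C

  regroup : ∀ X Z {Y} → Var (X ++ Z) ∪ Var Y ⊆ Var X ∪ Var (Z ++ Y)
  regroup X Z (inj₁ v) = Sum.map₂ ∈-++⁺ˡ (∈-++⁻ X v)
  regroup X Z (inj₂ y) = inj₂ (∈-++⁺ʳ Z y)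

  -- z̄₀ = … = z̄ₖ₋₁ is written as the conjunction of all z̄ᵢ = z̄ⱼ with i < j.
  Normal : Pred FormulaPair (suc ℓ) → Set (suc ℓ)
  Normal Ω = ∀ X Z Y k (φ : Formula (Var (X ++ Z) ∪ Var Y)) (ψ : Formula (Copies k Y)) →
    Ω (pair k φ ψ) →
    Ω (pair k (rename (regroup X Z) φ)
      (rename (λ (i , y) → i , ∈-++⁺ʳ Z y) ψ ∧̇
        ⋀[ k <_] (λ i j → equal Z (λ z → i , ∈-++⁺ˡ z) (λ z → j , ∈-++⁺ˡ z))))

{-# OPTIONS --safe #-}

-- The formula φ(x̄; uv̄) of a pair in Ξ_M has, for fixed x̄ and v̄, fewer than
-- k solutions u. Compactness therefore shows that, for k ≥ 2, φ(x̄; bv̄)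
-- divides over C exactly when b ∉ acl(Cv̄); for k ≤ 1 the formula φ is
-- inconsistent. Conversely every algebraic formula becomes the first member of
-- a pair in Ξ_M after conjoining that it has fewer than k solutions. So
-- ΞM-independence is the stated condition on acl, which is M-dividing
-- independence with acl(BD) replaced by B; enlarging B to acl(BC) makes up
-- for the difference, which disappears when passing to ⊥*.
--
-- Excluded middle on Σ-types produces witnesses, so no separate choice
-- principle is needed to build the dividing sequences.
module Submission where

open import Defs
open import Axiom.ExcludedMiddle using (ExcludedMiddle)
open import Data.Empty using (⊥; ⊥-elim)
open import Data.Fin as Fin using (Fin; zero; suc)
open import Data.Fin.Properties using (toℕ<n)
open import Data.List
  using (List; []; _∷_; _++_; [_]; map; length; concatMap; allFin; lookup; cartesianProduct)
open import Data.List.Properties using (map-++)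
open import Data.List.Membership.Propositional using (_∈_; _∉_)
open import Data.List.Membership.Propositional.Properties
open import Data.List.Relation.Unary.All as All using (All; []; _∷_)
open import Data.List.Relation.Unary.Any as Any using (here; there)
open import Data.List.Relation.Unary.Any.Properties using (lookup-index)
open import Data.Nat as ℕ using (ℕ; zero; suc; z≤n; s≤s)
import Data.Nat.Properties as ℕₚ
open import Data.Product using (Σ; Σ-syntax; ∃-syntax; _×_; _,_; proj₁; proj₂)
open import Data.Sum as Sum using (inj₁; inj₂; [_,_]′)
import Data.Unit as Unit
open import Function using (_∘_; _⇔_; mk⇔; id; Equivalence)
open import Level using () renaming (suc to lsuc)
open import Relation.Binary.PropositionalEquality
  using (_≡_; _≢_; refl; sym; trans; cong; cong₂; subst)
open import Relation.Nullary using (¬_; yes; no; contradiction)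
open import Relation.Unary using (｛_｝; _∪_; _∩_; _⊆_)
open Equivalence using (to; from)

module _ {ℓ} {L : Signature ℓ} (M : Structure L) where
  open BigModel M hiding (to; from)

  -- Satisfaction under renaming of variables.

  infixl 5 _▸_
  _▸_ : ∀ {Γ s} → Env Γ → Carrier s → Env (Γ ∪ ｛ s ｝)
  _▸_ {Γ} {s} e a = _⊕_ {Γ} {｛ s ｝} e (single a)

  mutual
    ⟦renameᵗ⟧ : ∀ {Γ Δ s} (ρ : Γ ⊆ Δ) {e : Env Δ} {e′ : Env Γ} →
      (∀ {s} (v : Γ s) → e (ρ v) ≡ e′ v) →
      (t : Term Γ s) → ⟦ renameᵗ ρ t ⟧ᵗ e ≡ ⟦ t ⟧ᵗ e′
    ⟦renameᵗ⟧ ρ h (var v)    = h v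
    ⟦renameᵗ⟧ ρ {e} {e′} h (fun f ts) = cong fun⟦ f ⟧ (⟦rename*⟧ ρ {e} {e′} h ts)

    ⟦rename*⟧ : ∀ {Γ Δ ss} (ρ : Γ ⊆ Δ) {e : Env Δ} {e′ : Env Γ} →
      (∀ {s} (v : Γ s) → e (ρ v) ≡ e′ v) →
      (ts : All (Term Γ) ss) → ⟦ rename* ρ ts ⟧* e ≡ ⟦ ts ⟧* e′
    ⟦rename*⟧ ρ h []       = refl
    ⟦rename*⟧ ρ {e} {e′} h (t ∷ ts) =
      cong₂ _∷_ (⟦renameᵗ⟧ ρ {e} {e′} h t) (⟦rename*⟧ ρ {e} {e′} h ts)

  mutual
    rename⁻ : ∀ {Γ Δ : Ctx} (ρ : Γ ⊆ Δ) {e : Env Δ} {e′ : Env Γ} →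
      (∀ {s} (v : Γ s) → e (ρ v) ≡ e′ v) →
      ∀ φ → ⊨ rename ρ φ ⟨ e ⟩ → ⊨ φ ⟨ e′ ⟩
    rename⁻ ρ {e} {e′} h (t ≈̇ u) p =
      trans (sym (⟦renameᵗ⟧ ρ {e} {e′} h t)) (trans p (⟦renameᵗ⟧ ρ {e} {e′} h u))
    rename⁻ ρ {e} {e′} h (rel R ts) = subst rel⟦ R ⟧ (⟦rename*⟧ ρ {e} {e′} h ts)
    rename⁻ ρ h ⊤̇ _ = _
    rename⁻ ρ h (¬̇ φ) p q = p (rename⁺ ρ h φ q)
    rename⁻ ρ h (φ ∧̇ ψ) (p , q) = rename⁻ ρ h φ p , rename⁻ ρ h ψ q
    rename⁻ ρ h (∃̇ s φ) (a , p) =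
      a , rename⁻ (Sum.map₁ ρ) (λ { (inj₁ v) → h v ; (inj₂ _) → refl }) φ p

    rename⁺ : ∀ {Γ Δ : Ctx} (ρ : Γ ⊆ Δ) {e : Env Δ} {e′ : Env Γ} →
      (∀ {s} (v : Γ s) → e (ρ v) ≡ e′ v) →
      ∀ φ → ⊨ φ ⟨ e′ ⟩ → ⊨ rename ρ φ ⟨ e ⟩
    rename⁺ ρ {e} {e′} h (t ≈̇ u) p =
      trans (⟦renameᵗ⟧ ρ {e} {e′} h t) (trans p (sym (⟦renameᵗ⟧ ρ {e} {e′} h u)))
    rename⁺ ρ {e} {e′} h (rel R ts) = subst rel⟦ R ⟧ (sym (⟦rename*⟧ ρ {e} {e′} h ts))
    rename⁺ ρ h ⊤̇ _ = _
    rename⁺ ρ h (¬̇ φ) p q = p (rename⁻ ρ h φ q)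
    rename⁺ ρ h (φ ∧̇ ψ) (p , q) = rename⁺ ρ h φ p , rename⁺ ρ h ψ q
    rename⁺ ρ h (∃̇ s φ) (a , p) =
      a , rename⁺ (Sum.map₁ ρ) (λ { (inj₁ v) → h v ; (inj₂ _) → refl }) φ p

  ⊨-cong : ∀ {Γ : Ctx} {e e′ : Env Γ} → (∀ {s} (v : Γ s) → e v ≡ e′ v) →
    ∀ φ → ⊨ φ ⟨ e ⟩ → ⊨ φ ⟨ e′ ⟩
  ⊨-cong {e = e} {e′} h φ p = rename⁻ id {e} {e′} h φ (rename⁺ id {e} {e} (λ _ → refl) φ p)

  -- Formulas mention only finitely many variables.

  -- Γ is the part of the context to be made finite; the detour through Θ
  -- lets the induction pass under quantifiers, which enlarge only Δ.
  record FinitePart {Γ Δ Θ : Ctx} (σ : Θ ⊆ Γ ∪ Δ) (P : Env Θ → Set (lsuc ℓ)) : Set (lsuc ℓ) where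
    constructor finitePart
    field
      vars    : List Sort
      incl    : Var vars ⊆ Γ
      formula : Formula (Var vars ∪ Δ)
      sat⁺    : ∀ (e : Env (Γ ∪ Δ)) → P (λ v → e (σ v)) → ⊨ formula ⟨ (λ v → e (Sum.map₁ incl v)) ⟩
      sat⁻    : ∀ (e : Env (Γ ∪ Δ)) → ⊨ formula ⟨ (λ v → e (Sum.map₁ incl v)) ⟩ → P (λ v → e (σ v))

  record FinitePartᵗ {Γ Δ Θ : Ctx} (σ : Θ ⊆ Γ ∪ Δ) (s : Sort) (t : Env Θ → Carrier s) : Set (lsuc ℓ) where
    constructor finitePartᵗ
    field
      vars : List Sort
      incl : Var vars ⊆ Γ
      term : Term (Var vars ∪ Δ) s
      eval : ∀ (e : Env (Γ ∪ Δ)) → ⟦ term ⟧ᵗ (λ v → e (Sum.map₁ incl v)) ≡ t (λ v → e (σ v))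

  record FinitePart* {Γ Δ Θ : Ctx} (σ : Θ ⊆ Γ ∪ Δ) (ss : List Sort) (t : Env Θ → All Carrier ss) :
      Set (lsuc ℓ) where
    constructor finitePart*
    field
      vars  : List Sort
      incl  : Var vars ⊆ Γ
      terms : All (Term (Var vars ∪ Δ)) ss
      eval  : ∀ (e : Env (Γ ∪ Δ)) → ⟦ terms ⟧* (λ v → e (Sum.map₁ incl v)) ≡ t (λ v → e (σ v))

  join : ∀ {Γ : Ctx} X {X′} → Var X ⊆ Γ → Var X′ ⊆ Γ → Var (X ++ X′) ⊆ Γ
  join []      ρ ρ′ v           = ρ′ v
  join (_ ∷ X) ρ ρ′ (here p)    = ρ (here p)
  join (_ ∷ X) ρ ρ′ (there v)   = join X (ρ ∘ there) ρ′ v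

  join-ˡ : ∀ {Γ : Ctx} {X X′ s} (ρ : Var X ⊆ Γ) (ρ′ : Var X′ ⊆ Γ) (v : Var X s) →
    join X {X′} ρ ρ′ (∈-++⁺ˡ v) ≡ ρ v
  join-ˡ ρ ρ′ (here p)  = refl
  join-ˡ ρ ρ′ (there v) = join-ˡ (ρ ∘ there) ρ′ v

  join-ʳ : ∀ {Γ : Ctx} X {X′ s} (ρ : Var X ⊆ Γ) (ρ′ : Var X′ ⊆ Γ) (v : Var X′ s) →
    join X ρ ρ′ (∈-++⁺ʳ X v) ≡ ρ′ v
  join-ʳ []      ρ ρ′ v = refl
  join-ʳ (_ ∷ X) ρ ρ′ v = join-ʳ X (ρ ∘ there) ρ′ v

  module _ {Γ Δ : Ctx} {X X′} (ρ : Var X ⊆ Γ) (ρ′ : Var X′ ⊆ Γ) (e : Env (Γ ∪ Δ)) where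
    map-join-ˡ : ∀ {s} (v : (Var X ∪ Δ) s) →
      e (Sum.map₁ (join X {X′} ρ ρ′) (Sum.map₁ ∈-++⁺ˡ v)) ≡ e (Sum.map₁ ρ v)
    map-join-ˡ (inj₁ v) = cong (e ∘ inj₁) (join-ˡ ρ ρ′ v)
    map-join-ˡ (inj₂ d) = refl

    map-join-ʳ : ∀ {s} (v : (Var X′ ∪ Δ) s) →
      e (Sum.map₁ (join X ρ ρ′) (Sum.map₁ (∈-++⁺ʳ X) v)) ≡ e (Sum.map₁ ρ′ v)
    map-join-ʳ (inj₁ v) = cong (e ∘ inj₁) (join-ʳ X ρ ρ′ v)
    map-join-ʳ (inj₂ d) = refl

  mutual
    finPartᵗ : ∀ {Γ Δ Θ : Ctx} (σ : Θ ⊆ Γ ∪ Δ) {s} (t : Term Θ s) →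
      FinitePartᵗ {Γ} {Δ} {Θ} σ s (⟦ t ⟧ᵗ)
    finPartᵗ {Γ} {Δ} {Θ} σ {s} (var v) with σ v in eq
    ... | inj₁ g = finitePartᵗ [ s ] (λ { (here refl) → g }) (var (inj₁ (here refl)))
          (λ (e : Env (Γ ∪ Δ)) → sym (cong e eq))
    ... | inj₂ d = finitePartᵗ [] (λ ()) (var (inj₂ d)) (λ (e : Env (Γ ∪ Δ)) → sym (cong e eq))
    finPartᵗ {Γ} {Δ} σ (fun f ts) = let finitePart* X ρ us h = finPart* {Γ} {Δ} σ ts in
      finitePartᵗ X ρ (fun f us) (λ (e : Env (Γ ∪ Δ)) → cong fun⟦ f ⟧ (h e))

    finPart* : ∀ {Γ Δ Θ : Ctx} (σ : Θ ⊆ Γ ∪ Δ) {ss} (ts : All (Term Θ) ss) →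
      FinitePart* {Γ} {Δ} {Θ} σ ss (⟦ ts ⟧*)
    finPart* σ [] = finitePart* [] (λ ()) [] (λ _ → refl)
    finPart* {Γ} {Δ} σ (t ∷ ts) =
      let finitePartᵗ X ρ u h = finPartᵗ {Γ} {Δ} σ t
          finitePart* X′ ρ′ us h′ = finPart* {Γ} {Δ} σ ts
      in finitePart* (X ++ X′) (join X ρ ρ′)
           (renameᵗ (Sum.map₁ ∈-++⁺ˡ) u ∷ rename* (Sum.map₁ (∈-++⁺ʳ X)) us)
           (λ (e : Env (Γ ∪ Δ)) → cong₂ _∷_
             (trans (⟦renameᵗ⟧ (Sum.map₁ ∈-++⁺ˡ) (map-join-ˡ {Δ = Δ} ρ ρ′ e) u) (h e))
             (trans (⟦rename*⟧ (Sum.map₁ (∈-++⁺ʳ X)) (map-join-ʳ {Δ = Δ} ρ ρ′ e) us) (h′ e)))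

  finPart : ∀ {Γ Δ Θ : Ctx} (σ : Θ ⊆ Γ ∪ Δ) (φ : Formula Θ) → FinitePart {Γ} {Δ} {Θ} σ (⊨ φ ⟨_⟩)
  finPart {Γ} {Δ} σ (t ≈̇ u) =
    let finitePartᵗ X ρ t′ h = finPartᵗ {Γ} {Δ} σ t
        finitePartᵗ X′ ρ′ u′ h′ = finPartᵗ {Γ} {Δ} σ u
        eq  = λ (e : Env (Γ ∪ Δ)) →
          trans (⟦renameᵗ⟧ (Sum.map₁ ∈-++⁺ˡ) (map-join-ˡ {Δ = Δ} ρ ρ′ e) t′) (h e)
        eq′ = λ (e : Env (Γ ∪ Δ)) →
          trans (⟦renameᵗ⟧ (Sum.map₁ (∈-++⁺ʳ X)) (map-join-ʳ {Δ = Δ} ρ ρ′ e) u′) (h′ e)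
    in finitePart (X ++ X′) (join X ρ ρ′)
         (renameᵗ (Sum.map₁ ∈-++⁺ˡ) t′ ≈̇ renameᵗ (Sum.map₁ (∈-++⁺ʳ X)) u′)
         (λ (e : Env (Γ ∪ Δ)) p → trans (eq e) (trans p (sym (eq′ e))))
         (λ (e : Env (Γ ∪ Δ)) p → trans (sym (eq e)) (trans p (eq′ e)))
  finPart {Γ} {Δ} σ (rel R ts) = let finitePart* X ρ us h = finPart* {Γ} {Δ} σ ts in
    finitePart X ρ (rel R us) (λ (e : Env (Γ ∪ Δ)) → subst rel⟦ R ⟧ (sym (h e)))
      (λ (e : Env (Γ ∪ Δ)) → subst rel⟦ R ⟧ (h e))
  finPart σ ⊤̇ = finitePart [] (λ ()) ⊤̇ _ _
  finPart {Γ} {Δ} σ (¬̇ φ) = let finitePart X ρ φ′ h⁺ h⁻ = finPart {Γ} {Δ} σ φ in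
    finitePart X ρ (¬̇ φ′) (λ (e : Env (Γ ∪ Δ)) p q → p (h⁻ e q)) (λ (e : Env (Γ ∪ Δ)) p q → p (h⁺ e q))
  finPart {Γ} {Δ} σ (φ ∧̇ ψ) =
    let finitePart X ρ φ′ h⁺ h⁻ = finPart {Γ} {Δ} σ φ
        finitePart X′ ρ′ ψ′ k⁺ k⁻ = finPart {Γ} {Δ} σ ψ
    in finitePart (X ++ X′) (join X ρ ρ′)
         (rename (Sum.map₁ ∈-++⁺ˡ) φ′ ∧̇ rename (Sum.map₁ (∈-++⁺ʳ X)) ψ′)
         (λ (e : Env (Γ ∪ Δ)) (p , q) →
           rename⁺ _ (map-join-ˡ {Δ = Δ} ρ ρ′ e) φ′ (h⁺ e p) ,
           rename⁺ _ (map-join-ʳ {Δ = Δ} ρ ρ′ e) ψ′ (k⁺ e q))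
         (λ (e : Env (Γ ∪ Δ)) (p , q) →
           h⁻ e (rename⁻ _ (map-join-ˡ {Δ = Δ} ρ ρ′ e) φ′ p) ,
           k⁻ e (rename⁻ _ (map-join-ʳ {Δ = Δ} ρ ρ′ e) ψ′ q))
  finPart {Γ} {Δ} {Θ} σ (∃̇ s φ) =
    -- The bound variable joins `Δ`, so it is never put on the list `vars`; `assoc` then returns it
    -- to the last position, where `∃̇` binds it.
    let finitePart X ρ φ′ h⁺ h⁻ = finPart {Γ} {Δ ∪ ｛ s ｝} σ′ φ
        assoc : Var X ∪ (Δ ∪ ｛ s ｝) ⊆ (Var X ∪ Δ) ∪ ｛ s ｝
        assoc = Sum.assocˡ
        agree : ∀ (e : Env (Γ ∪ Δ)) a {t} (v : (Var X ∪ (Δ ∪ ｛ s ｝)) t) →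
          (_▸_ {Var X ∪ Δ} (λ v → e (Sum.map₁ ρ v)) a) (assoc v) ≡ env e a (Sum.map₁ ρ v)
        agree = λ { e a (inj₁ x) → refl ; e a (inj₂ (inj₁ d)) → refl ; e a (inj₂ (inj₂ p)) → refl }
    in finitePart X ρ (∃̇ s (rename assoc φ′))
         (λ (e : Env (Γ ∪ Δ)) (a , p) →
           a , rename⁺ assoc (agree e a) φ′ (h⁺ (env e a) (⊨-cong (σ′-agree e a) φ p)))
         (λ (e : Env (Γ ∪ Δ)) (a , p) →
           a , ⊨-cong (λ v → sym (σ′-agree e a v)) φ (h⁻ (env e a) (rename⁻ assoc (agree e a) φ′ p)))
    where
    σ′ : Θ ∪ ｛ s ｝ ⊆ Γ ∪ (Δ ∪ ｛ s ｝)
    σ′ (inj₁ v) = Sum.map₂ inj₁ (σ v)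
    σ′ (inj₂ p) = inj₂ (inj₂ p)
    env : Env (Γ ∪ Δ) → Carrier s → Env (Γ ∪ (Δ ∪ ｛ s ｝))
    env e a (inj₁ g)        = e (inj₁ g)
    env e a (inj₂ (inj₁ d)) = e (inj₂ d)
    env e a (inj₂ (inj₂ p)) = single a p
    σ′-agree : ∀ (e : Env (Γ ∪ Δ)) a {t} (v : (Θ ∪ ｛ s ｝) t) →
      (_▸_ {Θ} (λ v → e (σ v)) a) v ≡ env e a (σ′ v)
    σ′-agree e a (inj₁ v) with σ v
    ... | inj₁ _ = refl
    ... | inj₂ _ = refl
    σ′-agree e a (inj₂ p) = refl

  -- Counting solutions within first-order logic.

  Property : Sort → Set (lsuc (lsuc ℓ))
  Property s = Carrier s → Set (lsuc ℓ)

  -- Distinctness is asked for `i < j` only, the form in which `⋀[ k <_]` and dividing sequences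
  -- deliver it; symmetry covers the other pairs.
  Many : ∀ {s} → ℕ → Property s → Set (lsuc ℓ)
  Many {s} n P = Σ[ c ∈ (Fin n → Carrier s) ] (∀ i → P (c i)) × (∀ {i j} → i Fin.< j → c i ≢ c j)

  -- The list need only cover `P`: it may contain repetitions and elements outside `P`.
  Finite : ∀ {s} → Property s → Set (lsuc ℓ)
  Finite {s} P = ∃[ as ] (∀ a → P a → a ∈ as)

  Many-map : ∀ {s n} {P Q : Property s} → (∀ a → P a → Q a) → Many n P → Many n Q
  Many-map h (c , p , d) = c , (λ i → h _ (p i)) , d

  Many-∷ : ∀ {s n} {P : Property s} a → P a → Many n (λ b → P b × ¬ b ≡ a) → Many (suc n) P
  Many-∷ {s} {n} {P} a pa (c , p , d) = c′ , p′ , (λ {i} {j} → d′ i j)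
    where
    c′ : Fin (suc n) → Carrier s
    c′ zero    = a
    c′ (suc i) = c i
    p′ : ∀ i → P (c′ i)
    p′ zero    = pa
    p′ (suc i) = proj₁ (p i)
    d′ : ∀ i j → i Fin.< j → c′ i ≢ c′ j
    d′ zero    (suc j) _         eq = proj₂ (p j) (sym eq)
    d′ (suc i) (suc j) (s≤s i<j) eq = d i<j eq

  Many-uncons : ∀ {s n} {P : Property s} → Many (suc n) P →
    Σ[ a ∈ Carrier s ] P a × Many n (λ b → P b × ¬ b ≡ a)
  Many-uncons (c , p , d) =
    c zero , p zero , c ∘ suc , (λ i → p (suc i) , λ eq → d (s≤s z≤n) (sym eq)) , (λ i<j → d (s≤s i<j))

  Sol : ∀ {Γ s} → Formula (Γ ∪ ｛ s ｝) → Env Γ → Property s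
  Sol {Γ} φ e a = ⊨ φ ⟨ _▸_ {Γ} e a ⟩

  excludeLast : ∀ {Γ : Ctx} {s} → Formula (Γ ∪ ｛ s ｝) → Formula ((Γ ∪ ｛ s ｝) ∪ ｛ s ｝)
  excludeLast φ = rename (Sum.map₁ inj₁) φ ∧̇ ¬̇ (var (inj₂ refl) ≈̇ var (inj₁ (inj₂ refl)))

  -- The first-order counterpart of `Many n`: a solution once picked becomes a parameter, and
  -- `excludeLast` removes it from the solutions still to be counted.
  many : ∀ {Γ : Ctx} {s} → ℕ → Formula (Γ ∪ ｛ s ｝) → Formula Γ
  many zero    φ = ⊤̇
  many (suc n) φ = ∃̇ _ (φ ∧̇ many n (excludeLast φ))

  module _ {Γ : Ctx} {s} (φ : Formula (Γ ∪ ｛ s ｝)) (e : Env Γ) (b : Carrier s) where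
    Sol-excludeLast⁺ : ∀ a → Sol φ e a × ¬ a ≡ b → Sol (excludeLast φ) (_▸_ {Γ} e b) a
    Sol-excludeLast⁺ a (p , a≢b) = rename⁺ _ (λ { (inj₁ _) → refl ; (inj₂ _) → refl }) φ p , a≢b

    Sol-excludeLast⁻ : ∀ a → Sol (excludeLast φ) (_▸_ {Γ} e b) a → Sol φ e a × ¬ a ≡ b
    Sol-excludeLast⁻ a (p , a≢b) = rename⁻ _ (λ { (inj₁ _) → refl ; (inj₂ _) → refl }) φ p , a≢b

  many⁺ : ∀ {Γ s} n (φ : Formula (Γ ∪ ｛ s ｝)) (e : Env Γ) → Many n (Sol φ e) → ⊨ many n φ ⟨ e ⟩
  many⁺ zero    φ e m = _
  many⁺ {Γ} (suc n) φ e m =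
    let b , p , m′ = Many-uncons {P = Sol φ e} m
        e′ = _▸_ {Γ} e b
    in b , p , many⁺ n (excludeLast φ) e′
         (Many-map {P = λ a → Sol φ e a × ¬ a ≡ b} {Sol (excludeLast φ) e′} (Sol-excludeLast⁺ φ e b) m′)

  many⁻ : ∀ {Γ s} n (φ : Formula (Γ ∪ ｛ s ｝)) (e : Env Γ) → ⊨ many n φ ⟨ e ⟩ → Many n (Sol φ e)
  many⁻ zero    φ e m = (λ ()) , (λ ()) , λ { {()} }
  many⁻ {Γ} (suc n) φ e (b , p , m) =
    let e′ = _▸_ {Γ} e b
    in Many-∷ {P = Sol φ e} b p
         (Many-map {P = Sol (excludeLast φ) e′} {λ a → Sol φ e a × ¬ a ≡ b} (Sol-excludeLast⁻ φ e b)
           (many⁻ n (excludeLast φ) e′ m))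

  remove : ∀ {s} {a : Carrier s} {as} → a ∈ as → List (Carrier s)
  remove {as = _ ∷ as} (here _)  = as
  remove {as = b ∷ _}  (there p) = b ∷ remove p

  remove-∈ : ∀ {s} {a b : Carrier s} {as} (p : a ∈ as) → b ∈ as → ¬ b ≡ a → b ∈ remove p
  remove-∈ (here refl) (here refl) b≢a = ⊥-elim (b≢a refl)
  remove-∈ (here _)    (there q)   b≢a = q
  remove-∈ (there p)   (here eq)   b≢a = here eq
  remove-∈ (there p)   (there q)   b≢a = there (remove-∈ p q b≢a)

  remove-length : ∀ {s} {a : Carrier s} {as} (p : a ∈ as) → suc (length (remove p)) ≡ length as
  remove-length (here _)  = refl
  remove-length (there p) = cong suc (remove-length p)

  -- Pigeonhole, by induction on the length: the first element is deleted from the list and excluded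
  -- from `P`.
  Finite⇒¬Many : ∀ {s} n {P : Property s} (F : Finite P) → length (proj₁ F) ≡ n → ¬ Many (suc n) P
  Finite⇒¬Many zero    {P} ([] , h) eq m = let a , p , _ = Many-uncons {P = P} m in contradiction (h a p) λ ()
  Finite⇒¬Many (suc n) {P} (as , h) eq m =
    let a , p , m′ = Many-uncons {P = P} m
    in Finite⇒¬Many n {λ b → P b × ¬ b ≡ a}
         (remove (h a p) , λ b (q , b≢a) → remove-∈ (h a p) (h b q) b≢a)
         (ℕₚ.suc-injective (trans (remove-length (h a p)) eq)) m′

  ℕ-Many : ∀ {s} {P : Property s} (f : ℕ → Carrier s) → (∀ i → P (f i)) →
    (∀ {i j} → i ℕ.< j → f i ≢ f j) → ∀ n → Many n P
  ℕ-Many f p d n = f ∘ Fin.toℕ , p ∘ Fin.toℕ , d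

  -- Inconsistency pairs in Ξ_M

  -- Compares positions, since `u` and `v` may have different sorts and hence different types. It
  -- computes to the empty or the unit type, so its proofs can be filled in by `_`.
  Off : ∀ {Y s t} → Var Y s → Var Y t → Set
  Off (here _)  (here _)  = ⊥
  Off (here _)  (there _) = Unit.⊤
  Off (there _) (here _)  = Unit.⊤
  Off (there u) (there v) = Off u v

  Rest : ∀ {Y s} → Var Y s → Ctx
  Rest {Y} u t = Σ (Var Y t) (Off u)

  split : ∀ {Y s} (u : Var Y s) → Var Y ⊆ Rest u ∪ ｛ s ｝
  split (here refl) (here refl) = inj₂ refl
  split (here _)    (there v)   = inj₁ (there v , _)
  split (there u)   (here p)    = inj₁ (here p , _)
  split (there u)   (there v)   = Sum.map₁ (λ (w , o) → there w , o) (split u v)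

  split-same : ∀ {Y s} (u : Var Y s) → split u u ≡ inj₂ refl
  split-same (here refl) = refl
  split-same (there u) rewrite split-same u = refl

  split-other : ∀ {Y s t} (u : Var Y s) (v : Var Y t) (o : Off u v) → split u v ≡ inj₁ (v , o)
  split-other (here refl) (there v) o = refl
  split-other (there u)   (here p)  o = refl
  split-other (there u)   (there v) o rewrite split-other u v o = refl

  rest : ∀ {Y s} → Var Y s → Tuple Y → SmallSet
  rest u b = small (Rest u) (λ (v , _) → b v)

  -- Routed through `split`, so that renaming along `split u` turns a formula about the tuple into
  -- one about a single element with parameters `rest u b`.
  replace : ∀ {Y s} → Var Y s → Tuple Y → Carrier s → Tuple Y
  replace u b c v = (_▸_ {Rest u} (elem (rest u b)) c) (split u v)

  replace-same : ∀ {Y s} (u : Var Y s) (b : Tuple Y) c → replace u b c u ≡ c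
  replace-same u b c rewrite split-same u = refl

  replace-other : ∀ {Y s t} (u : Var Y s) (b : Tuple Y) c (v : Var Y t) → Off u v → replace u b c v ≡ b v
  replace-other u b c v o rewrite split-other u v o = refl

  replace-id : ∀ {Y s t} (u : Var Y s) (b : Tuple Y) (v : Var Y t) → replace u b (b u) v ≡ b v
  replace-id (here refl) b (here refl) = refl
  replace-id (here refl) b (there v)   = refl
  replace-id (there u)   b (here p)    = refl
  replace-id (there u)   b (there v) with split u v | replace-id u (λ w → b (there w)) v
  ... | inj₁ _    | eq = eq
  ... | inj₂ refl | eq = eq

  module _ {Γ : Ctx} (e : Env Γ) where

    ⊨-equal⁺ : ∀ Z (x y : Var Z ⊆ Γ) → (∀ {t} (v : Var Z t) → e (x v) ≡ e (y v)) → ⊨ equal Z x y ⟨ e ⟩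
    ⊨-equal⁺ []      x y h = _
    ⊨-equal⁺ (_ ∷ Z) x y h = h (here refl) , ⊨-equal⁺ Z (x ∘ there) (y ∘ there) (λ v → h (there v))

    ⊨-equal⁻ : ∀ Z (x y : Var Z ⊆ Γ) → ⊨ equal Z x y ⟨ e ⟩ → ∀ {t} (v : Var Z t) → e (x v) ≡ e (y v)
    ⊨-equal⁻ (_ ∷ Z) x y (p , q) (here refl) = p
    ⊨-equal⁻ (_ ∷ Z) x y (p , q) (there v)   = ⊨-equal⁻ Z (x ∘ there) (y ∘ there) q v

    DifferOnlyAt : ∀ {Y s} → Var Y s → (x y : Var Y ⊆ Γ) → Set (lsuc ℓ)
    DifferOnlyAt {Y} u x y = e (x u) ≢ e (y u) × (∀ {t} (v : Var Y t) → Off u v → e (x v) ≡ e (y v))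

    ⊨-differ⁺ : ∀ {Y s} (u : Var Y s) (x y : Var Y ⊆ Γ) → DifferOnlyAt u x y → ⊨ differOnlyAt u x y ⟨ e ⟩
    ⊨-differ⁺ (here refl) x y (d , h) = d , ⊨-equal⁺ _ (x ∘ there) (y ∘ there) (λ v → h (there v) _)
    ⊨-differ⁺ (there u)   x y (d , h) = h (here refl) _ ,
      ⊨-differ⁺ u (x ∘ there) (y ∘ there) (d , λ v → h (there v))

    ⊨-differ⁻ : ∀ {Y s} (u : Var Y s) (x y : Var Y ⊆ Γ) → ⊨ differOnlyAt u x y ⟨ e ⟩ → DifferOnlyAt u x y
    ⊨-differ⁻ (here refl) x y (d , h) = d , λ { (there v) _ → ⊨-equal⁻ _ (x ∘ there) (y ∘ there) h v }
    ⊨-differ⁻ (there u)   x y (p , q) = let d , h = ⊨-differ⁻ u (x ∘ there) (y ∘ there) q in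
      d , λ { (here refl) _ → p ; (there v) o → h v o }

    ⊨-⋀⁺ : ∀ {A : Set} (χ : A → Formula Γ) xs → (∀ {x} → x ∈ xs → ⊨ χ x ⟨ e ⟩) → ⊨ ⋀ (map χ xs) ⟨ e ⟩
    ⊨-⋀⁺ χ []       h = _
    ⊨-⋀⁺ χ (_ ∷ xs) h = h (here refl) , ⊨-⋀⁺ χ xs (h ∘ there)

    ⊨-⋀⁻ : ∀ {A : Set} (χ : A → Formula Γ) xs → ⊨ ⋀ (map χ xs) ⟨ e ⟩ → ∀ {x} → x ∈ xs → ⊨ χ x ⟨ e ⟩
    ⊨-⋀⁻ χ (_ ∷ _)  (p , q) (here refl) = p
    ⊨-⋀⁻ χ (_ ∷ xs) (p , q) (there i)   = ⊨-⋀⁻ χ xs q i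

    ⊨-conjuncts⁺ : ∀ φ → (∀ {χ} → χ ∈ conjuncts φ → ⊨ χ ⟨ e ⟩) → ⊨ φ ⟨ e ⟩
    ⊨-conjuncts⁺ (t ≈̇ u)    h = h (here refl)
    ⊨-conjuncts⁺ (rel R ts) h = h (here refl)
    ⊨-conjuncts⁺ ⊤̇          h = _
    ⊨-conjuncts⁺ (¬̇ φ)      h = h (here refl)
    ⊨-conjuncts⁺ (φ ∧̇ ψ)    h =
      ⊨-conjuncts⁺ φ (h ∘ ∈-++⁺ˡ) , ⊨-conjuncts⁺ ψ (h ∘ ∈-++⁺ʳ (conjuncts φ))
    ⊨-conjuncts⁺ (∃̇ s φ)    h = h (here refl)

    ⊨-conjuncts⁻ : ∀ φ → ⊨ φ ⟨ e ⟩ → ∀ {χ} → χ ∈ conjuncts φ → ⊨ χ ⟨ e ⟩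
    ⊨-conjuncts⁻ (t ≈̇ u)    p (here refl) = p
    ⊨-conjuncts⁻ (rel R ts) p (here refl) = p
    ⊨-conjuncts⁻ (¬̇ φ)      p (here refl) = p
    ⊨-conjuncts⁻ (φ ∧̇ ψ)    (p , q) i with ∈-++⁻ (conjuncts φ) i
    ... | inj₁ j = ⊨-conjuncts⁻ φ p j
    ... | inj₂ j = ⊨-conjuncts⁻ ψ q j
    ⊨-conjuncts⁻ (∃̇ s φ)    p (here refl) = p

    ⊨-≃ : ∀ {φ ψ} → φ ≃ ψ → ⊨ φ ⟨ e ⟩ → ⊨ ψ ⟨ e ⟩
    ⊨-≃ {φ} {ψ} eq p = ⊨-conjuncts⁺ ψ (λ i → ⊨-conjuncts⁻ φ p (from eq i))

  ∈-pairs : ∀ {k} {i j : Fin k} → i Fin.< j → (i , j) ∈ pairs k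
  ∈-pairs i<j = ∈-filter⁺ _ (∈-cartesianProduct⁺ (∈-allFin _) (∈-allFin _)) i<j

  pairs-< : ∀ {k} {i j : Fin k} → (i , j) ∈ pairs k → i Fin.< j
  pairs-< {k} p = proj₂ (∈-filter⁻ (λ (i , j) → i Fin.<? j) {xs = cartesianProduct (allFin k) (allFin k)} p)

  ⊨-⋀<⁺ : ∀ {Γ : Ctx} {k} {χ : Fin k → Fin k → Formula Γ} (e : Env Γ) →
    (∀ {i j} → i Fin.< j → ⊨ χ i j ⟨ e ⟩) → ⊨ ⋀[ k <_] χ ⟨ e ⟩
  ⊨-⋀<⁺ {k = k} {χ} e h = ⊨-⋀⁺ e (λ (i , j) → χ i j) (pairs k) (h ∘ pairs-<)

  ⊨-⋀<⁻ : ∀ {Γ : Ctx} {k} {χ : Fin k → Fin k → Formula Γ} (e : Env Γ) →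
    ⊨ ⋀[ k <_] χ ⟨ e ⟩ → ∀ {i j} → i Fin.< j → ⊨ χ i j ⟨ e ⟩
  ⊨-⋀<⁻ {k = k} {χ} e p i<j = ⊨-⋀⁻ e (λ (i , j) → χ i j) (pairs k) p (∈-pairs i<j)

  allDiffer : ∀ {Y s} k → Var Y s → Formula (Copies k Y)
  allDiffer k u = ⋀[ k <_] (λ i j → differOnlyAt u (i ,_) (j ,_))

  module _ {X Y k s} {φ : Formula (Var X ∪ Var Y)} {ψ : Formula (Copies k Y)} (u : Var Y s)
           (ξ : Ξ (pair k φ ψ)) (eq : ψ ≃ allDiffer k u) where

    -- Distinct values `c i` would turn `b` into `k` copies that agree off `u`, differ pairwise at
    -- `u` and satisfy `φ` with the same `a`. Such copies realise `ψ`, against `ξ`.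
    few-replacements : ∀ (a : Tuple X) (b : Tuple Y) →
      ¬ Many k (λ c → ⊨ φ ⟨ _⊕_ {Var X} {Var Y} a (replace u b c) ⟩)
    few-replacements a b (c , p , d) = ξ (e ,
      ⊨-⋀⁺ e _ (allFin k) (λ {i} _ → rename⁺ _ (λ { (inj₁ _) → refl ; (inj₂ _) → refl }) φ (p i)) ,
      rename⁺ inj₂ (λ _ → refl) ψ
        (⊨-≃ copies {allDiffer k u} {ψ} (mk⇔ (from eq) (to eq))
          (⊨-⋀<⁺ copies λ {i} {j} i<j → ⊨-differ⁺ copies u (i ,_) (j ,_)
            ( (λ q → d i<j (trans (sym (replace-same u b (c i))) (trans q (replace-same u b (c j)))))
            , λ v o → trans (replace-other u b (c i) v o) (sym (replace-other u b (c j) v o))))))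
      where
      copies : Env (Copies k Y)
      copies (i , v) = replace u b (c i) v
      e : Env (Var X ∪ Copies k Y)
      e (inj₁ x) = a x
      e (inj₂ v) = copies v

  module _ {X V s} (n : ℕ) (χ : Formula ((Var X ∪ Var V) ∪ ｛ s ｝)) where

    distinguish : (Var X ∪ Var V) ∪ ｛ s ｝ ⊆ Var X ∪ Var (s ∷ V)
    distinguish (inj₁ (inj₁ x)) = inj₁ x
    distinguish (inj₁ (inj₂ v)) = inj₂ (there v)
    distinguish (inj₂ refl)     = inj₂ (here refl)

    -- The count is part of the formula, so the bound holds for every choice of parameters and not
    -- only for those at which `χ` was algebraic. `distinguish` puts the solved variable first in
    -- the right-hand block.
    fewSolutions : Formula (Var X ∪ Var (s ∷ V))
    fewSolutions = rename distinguish (χ ∧̇ ¬̇ rename inj₁ (many n χ))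

    module _ (a : Tuple X) (b : Tuple (s ∷ V)) where

      tail : Env (Var X ∪ Var V)
      tail (inj₁ x) = a x
      tail (inj₂ v) = b (there v)

      distinguish-agree : ∀ {t} (v : ((Var X ∪ Var V) ∪ ｛ s ｝) t) →
        (_⊕_ {Var X} {Var (s ∷ V)} a b) (distinguish v) ≡ (_▸_ {Var X ∪ Var V} tail (b (here refl))) v
      distinguish-agree (inj₁ (inj₁ _)) = refl
      distinguish-agree (inj₁ (inj₂ _)) = refl
      distinguish-agree (inj₂ refl)     = refl

      ⊨-fewSolutions⁺ : Sol χ tail (b (here refl)) → ¬ Many n (Sol χ tail) →
        ⊨ fewSolutions ⟨ _⊕_ {Var X} {Var (s ∷ V)} a b ⟩
      ⊨-fewSolutions⁺ p few = rename⁺ distinguish distinguish-agree (χ ∧̇ ¬̇ rename inj₁ (many n χ))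
        (p , λ m → few (many⁻ n χ tail (rename⁻ inj₁ (λ _ → refl) (many n χ) m)))

      ⊨-fewSolutions⁻ : ⊨ fewSolutions ⟨ _⊕_ {Var X} {Var (s ∷ V)} a b ⟩ →
        Sol χ tail (b (here refl)) × ¬ Many n (Sol χ tail)
      ⊨-fewSolutions⁻ p =
        let q , few = rename⁻ distinguish distinguish-agree (χ ∧̇ ¬̇ rename inj₁ (many n χ)) p
        in q , λ m → few (rename⁺ inj₁ (λ _ → refl) (many n χ) (many⁺ n χ tail m))

  -- The copies share all entries other than `u`, so their distinct entries at `u` are `suc n`
  -- solutions of `χ` over the parameters of copy 0, which the count inside copy 0 forbids. The
  -- successor guarantees that copy 0 exists.
  fewSolutions∈Ξ : ∀ {X V s} n (χ : Formula ((Var X ∪ Var V) ∪ ｛ s ｝)) →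
    Ξ (pair (suc n) (fewSolutions (suc n) χ) (allDiffer (suc n) (here refl)))
  fewSolutions∈Ξ {X} {V} {s} n χ (e , ps , q) = proj₂ (each zero)
    ((λ i → b i (here refl)) , solves , λ i<j → proj₁ (differ i<j))
    where
    a : Tuple X
    a x = e (inj₁ x)
    b : Fin (suc n) → Tuple (s ∷ V)
    b i v = e (inj₂ (i , v))
    copies : Env (Copies (suc n) (s ∷ V))
    copies v = e (inj₂ v)
    u : Var (s ∷ V) s
    u = here refl
    differ : ∀ {i j} → i Fin.< j → DifferOnlyAt copies u (i ,_) (j ,_)
    differ {i} {j} i<j = ⊨-differ⁻ copies u (i ,_) (j ,_)
      (⊨-⋀<⁻ copies (rename⁻ inj₂ (λ _ → refl) (allDiffer (suc n) u) q) i<j)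
    each : ∀ i → Sol χ (tail (suc n) χ a (b i)) (b i u) × ¬ Many (suc n) (Sol χ (tail (suc n) χ a (b i)))
    each i = ⊨-fewSolutions⁻ (suc n) χ a (b i)
      (rename⁻ (Sum.map₂ (i ,_)) (λ { (inj₁ _) → refl ; (inj₂ _) → refl }) (fewSolutions (suc n) χ)
        (⊨-⋀⁻ e _ (allFin (suc n)) ps (∈-allFin i)))
    constant : ∀ i {t} (v : Var V t) → b i (there v) ≡ b zero (there v)
    constant zero    v = refl
    constant (suc i) v = sym (proj₂ (differ {zero} {suc i} (s≤s z≤n)) (there v) _)
    solves : ∀ i → Sol χ (tail (suc n) χ a (b zero)) (b i u)
    solves i = ⊨-cong (λ { (inj₁ (inj₁ _)) → refl ; (inj₁ (inj₂ v)) → constant i v ; (inj₂ _) → refl }) χ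
      (proj₁ (each i))

  -- Finite support in two blocks of variables.

  record FiniteSupport {Γ Δ : Ctx} {s} (χ : Formula ((Γ ∪ Δ) ∪ ｛ s ｝)) : Set (lsuc ℓ) where
    constructor finiteSupport
    field
      {X V}   : List Sort
      left    : Var X ⊆ Γ
      right   : Var V ⊆ Δ
      formula : Formula ((Var X ∪ Var V) ∪ ｛ s ｝)
    restrict : Env (Γ ∪ Δ) → Env (Var X ∪ Var V)
    restrict e v = e (Sum.map left right v)
    field
      sat⁺    : ∀ (e : Env (Γ ∪ Δ)) c → Sol χ e c → Sol formula (restrict e) c
      sat⁻    : ∀ (e : Env (Γ ∪ Δ)) c → Sol formula (restrict e) c → Sol χ e c

  -- The variables from `Γ` and `Δ` are kept apart because they end up in different blocks: in the
  -- application, those naming elements of A become the left-hand block, those naming elements of D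
  -- become part of the dividing tuple.
  support : ∀ {Γ Δ : Ctx} {s} (χ : Formula ((Γ ∪ Δ) ∪ ｛ s ｝)) → FiniteSupport {Γ} {Δ} χ
  support {Γ} {Δ} {s} χ =
    let finitePart X α χ₁ sat₁⁺ sat₁⁻ = finPart {Γ} {Δ ∪ ｛ s ｝} Sum.assocʳ χ
        -- Second pass: `Δ` is made finite, while the variables kept from `Γ` and the solved
        -- variable stay fixed.
        finitePart V δ χ₂ sat₂⁺ sat₂⁻ = finPart {Δ} {Var X ∪ ｛ s ｝} (exchange (Var X)) χ₁
        agree₁ : ∀ (e : Env (Γ ∪ Δ)) (c : Carrier s) {t} (v : (Var X ∪ (Δ ∪ ｛ s ｝)) t) →
          env₁ e c (Sum.map₁ α v) ≡ env₂ α e c (exchange (Var X) v)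
        agree₁ = λ { e c (inj₁ _) → refl ; e c (inj₂ (inj₁ _)) → refl ; e c (inj₂ (inj₂ _)) → refl }
        agree₂ : ∀ (e : Env (Γ ∪ Δ)) (c : Carrier s) {t} (v : (Var V ∪ (Var X ∪ ｛ s ｝)) t) →
          (_▸_ {Var X ∪ Var V} (λ v → e (Sum.map α δ v)) c) (collect v) ≡ env₂ α e c (Sum.map₁ δ v)
        agree₂ = λ { e c (inj₁ _) → refl ; e c (inj₂ (inj₁ _)) → refl ; e c (inj₂ (inj₂ _)) → refl }
    in finiteSupport α δ (rename collect χ₂)
         (λ e c p → rename⁺ collect (agree₂ e c) χ₂
           (sat₂⁺ (env₂ α e c) (⊨-cong (agree₁ e c) χ₁ (sat₁⁺ (env₁ e c) (⊨-cong (agree-assoc e c) χ p)))))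
         (λ e c p → ⊨-cong (λ v → sym (agree-assoc e c v)) χ (sat₁⁻ (env₁ e c)
           (⊨-cong (λ v → sym (agree₁ e c v)) χ₁ (sat₂⁻ (env₂ α e c) (rename⁻ collect (agree₂ e c) χ₂ p)))))
    where
    exchange : (Ξ : Ctx) → Ξ ∪ (Δ ∪ ｛ s ｝) ⊆ Δ ∪ (Ξ ∪ ｛ s ｝)
    exchange Ξ (inj₁ x)        = inj₂ (inj₁ x)
    exchange Ξ (inj₂ (inj₁ d)) = inj₁ d
    exchange Ξ (inj₂ (inj₂ p)) = inj₂ (inj₂ p)
    collect : ∀ {X V} → Var V ∪ (Var X ∪ ｛ s ｝) ⊆ (Var X ∪ Var V) ∪ ｛ s ｝
    collect (inj₁ v)        = inj₁ (inj₂ v)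
    collect (inj₂ (inj₁ x)) = inj₁ (inj₁ x)
    collect (inj₂ (inj₂ p)) = inj₂ p
    env₁ : Env (Γ ∪ Δ) → Carrier s → Env (Γ ∪ (Δ ∪ ｛ s ｝))
    env₁ e c (inj₁ g)        = e (inj₁ g)
    env₁ e c (inj₂ (inj₁ d)) = e (inj₂ d)
    env₁ e c (inj₂ (inj₂ p)) = single c p
    env₂ : ∀ {X} → Var X ⊆ Γ → Env (Γ ∪ Δ) → Carrier s → Env (Δ ∪ (Var X ∪ ｛ s ｝))
    env₂ α e c (inj₁ d)        = e (inj₂ d)
    env₂ α e c (inj₂ (inj₁ x)) = e (inj₁ (α x))
    env₂ α e c (inj₂ (inj₂ p)) = single c p
    agree-assoc : ∀ (e : Env (Γ ∪ Δ)) c {t} (v : ((Γ ∪ Δ) ∪ ｛ s ｝) t) →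
      (_▸_ {Γ ∪ Δ} e c) v ≡ env₁ e c (Sum.assocʳ v)
    agree-assoc e c (inj₁ (inj₁ _)) = refl
    agree-assoc e c (inj₁ (inj₂ _)) = refl
    agree-assoc e c (inj₂ _)        = refl

  -- Normality of Ξ_M

  conjuncts-rename : ∀ {Γ Δ : Ctx} (ρ : Γ ⊆ Δ) φ →
    conjuncts (rename {Γ} {Δ} ρ φ) ≡ map (rename {Γ} {Δ} ρ) (conjuncts φ)
  conjuncts-rename ρ (t ≈̇ u)    = refl
  conjuncts-rename ρ (rel R ts) = refl
  conjuncts-rename ρ ⊤̇          = refl
  conjuncts-rename ρ (¬̇ φ)      = refl
  conjuncts-rename {Γ} {Δ} ρ (φ ∧̇ ψ)    =
    trans (cong₂ _++_ (conjuncts-rename {Γ} {Δ} ρ φ) (conjuncts-rename {Γ} {Δ} ρ ψ))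
      (sym (map-++ (rename {Γ} {Δ} ρ) (conjuncts φ) (conjuncts ψ)))
  conjuncts-rename ρ (∃̇ s φ)    = refl

  rename-equal : ∀ {Γ Δ : Ctx} (ρ : Γ ⊆ Δ) Z (x y : Var Z ⊆ Γ) →
    rename ρ (equal Z x y) ≡ equal Z (λ v → ρ (x v)) (λ v → ρ (y v))
  rename-equal ρ []      x y = refl
  rename-equal ρ (_ ∷ Z) x y = cong (_ ∧̇_) (rename-equal ρ Z (x ∘ there) (y ∘ there))

  rename-differ : ∀ {Γ Δ : Ctx} (ρ : Γ ⊆ Δ) {Y s} (u : Var Y s) (x y : Var Y ⊆ Γ) →
    rename ρ (differOnlyAt u x y) ≡ differOnlyAt u (λ v → ρ (x v)) (λ v → ρ (y v))
  rename-differ ρ (here _)  x y = cong (_ ∧̇_) (rename-equal ρ _ (x ∘ there) (y ∘ there))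
  rename-differ ρ (there u) x y = cong (_ ∧̇_) (rename-differ ρ u (x ∘ there) (y ∘ there))

  conjuncts-differ : ∀ {Γ : Ctx} Z {Y s} (u : Var Y s) (x y : Var (Z ++ Y) ⊆ Γ) →
    conjuncts (differOnlyAt (∈-++⁺ʳ Z u) x y) ≡
    conjuncts (equal Z (λ z → x (∈-++⁺ˡ z)) (λ z → y (∈-++⁺ˡ z))) ++
    conjuncts (differOnlyAt u (λ v → x (∈-++⁺ʳ Z v)) (λ v → y (∈-++⁺ʳ Z v)))
  conjuncts-differ []      u x y = refl
  conjuncts-differ (_ ∷ Z) u x y = cong (_ ∷_) (conjuncts-differ Z u (x ∘ there) (y ∘ there))

  ∈-conjuncts-⋀⁺ : ∀ {Γ : Ctx} {A : Set} (χ : A → Formula Γ) {xs x θ} →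
    x ∈ xs → θ ∈ conjuncts (χ x) → θ ∈ conjuncts (⋀ (map χ xs))
  ∈-conjuncts-⋀⁺ χ (here refl) p = ∈-++⁺ˡ p
  ∈-conjuncts-⋀⁺ χ {y ∷ _} (there i) p = ∈-++⁺ʳ (conjuncts (χ y)) (∈-conjuncts-⋀⁺ χ i p)

  ∈-conjuncts-⋀⁻ : ∀ {Γ : Ctx} {A : Set} (χ : A → Formula Γ) xs {θ} →
    θ ∈ conjuncts (⋀ (map χ xs)) → Σ[ x ∈ A ] x ∈ xs × θ ∈ conjuncts (χ x)
  ∈-conjuncts-⋀⁻ χ (x ∷ xs) p with ∈-++⁻ (conjuncts (χ x)) p
  ... | inj₁ q = x , here refl , q
  ... | inj₂ q = let y , i , r = ∈-conjuncts-⋀⁻ χ xs q in y , there i , r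

  module _ (Z : List Sort) {Y : List Sort} (k : ℕ) where

    inBlock : Copies k Y ⊆ Copies k (Z ++ Y)
    inBlock (i , y) = i , ∈-++⁺ʳ Z y

    lift : Formula (Copies k Y) → Formula (Copies k (Z ++ Y))
    lift = rename inBlock

    conjuncts-lift : ∀ φ → conjuncts (lift φ) ≡ map lift (conjuncts φ)
    conjuncts-lift = conjuncts-rename {Copies k Y} {Copies k (Z ++ Y)} inBlock

    allEqual : Formula (Copies k (Z ++ Y))
    allEqual = ⋀[ k <_] (λ i j → equal Z (λ z → i , ∈-++⁺ˡ z) (λ z → j , ∈-++⁺ˡ z))

    -- For a single pair `i < j`, moving `u` past the block `Z` only adds the equations of that
    -- block. The left side lists all of `ψ` before all the equations, whereas `allDiffer` groups
    -- them pair by pair; `≃` ignores this reordering.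
    normal-≃ : ∀ {s} (u : Var Y s) {ψ : Formula (Copies k Y)} → ψ ≃ allDiffer k u →
      (lift ψ ∧̇ allEqual) ≃ allDiffer k (∈-++⁺ʳ Z u)
    normal-≃ u {ψ} eq {θ} = mk⇔ forth back
      where
      eqs old new : Fin k × Fin k → Formula _
      eqs (i , j) = equal Z (λ z → i , ∈-++⁺ˡ z) (λ z → j , ∈-++⁺ˡ z)
      old (i , j) = differOnlyAt u (i ,_) (j ,_)
      new (i , j) = differOnlyAt (∈-++⁺ʳ Z u) (i ,_) (j ,_)
      conjuncts-old : ∀ x → conjuncts (lift (old x)) ≡ map lift (conjuncts (old x))
      conjuncts-old x = conjuncts-lift (old x)
      conjuncts-new : ∀ x → conjuncts (new x) ≡ conjuncts (eqs x) ++ conjuncts (lift (old x))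
      conjuncts-new (i , j) = trans (conjuncts-differ Z u (i ,_) (j ,_))
        (cong (λ χ → conjuncts (eqs (i , j)) ++ conjuncts χ) (sym (rename-differ inBlock u (i ,_) (j ,_))))
      forth : θ ∈ conjuncts (lift ψ ∧̇ allEqual) → θ ∈ conjuncts (allDiffer k (∈-++⁺ʳ Z u))
      forth p with ∈-++⁻ (conjuncts (lift ψ)) p
      ... | inj₂ q = let x , i , r = ∈-conjuncts-⋀⁻ eqs (pairs k) q in
        ∈-conjuncts-⋀⁺ new i (subst (θ ∈_) (sym (conjuncts-new x)) (∈-++⁺ˡ r))
      ... | inj₁ q with ∈-map⁻ lift (subst (θ ∈_) (conjuncts-lift ψ) q)
      ...   | θ₀ , r , refl = let x , i , t = ∈-conjuncts-⋀⁻ old (pairs k) (to eq r) in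
        ∈-conjuncts-⋀⁺ new i (subst (θ ∈_) (sym (conjuncts-new x))
          (∈-++⁺ʳ (conjuncts (eqs x)) (subst (θ ∈_) (sym (conjuncts-old x)) (∈-map⁺ lift t))))
      back : θ ∈ conjuncts (allDiffer k (∈-++⁺ʳ Z u)) → θ ∈ conjuncts (lift ψ ∧̇ allEqual)
      back p with ∈-conjuncts-⋀⁻ new (pairs k) p
      ... | x , i , q with ∈-++⁻ (conjuncts (eqs x)) (subst (θ ∈_) (conjuncts-new x) q)
      ...   | inj₁ r = ∈-++⁺ʳ (conjuncts (lift ψ)) (∈-conjuncts-⋀⁺ eqs i r)
      ...   | inj₂ r with ∈-map⁻ lift (subst (θ ∈_) (conjuncts-old x) r)
      ...     | θ₀ , t , refl = ∈-++⁺ˡ (subst (θ ∈_) (sym (conjuncts-lift ψ))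
                (∈-map⁺ lift (from eq (∈-conjuncts-⋀⁺ old i t))))

  -- The equations force the copies of the block `Z` to coincide. Their common value moves to the
  -- left-hand block, where it completes a solution of the original conjunction.
  normal-Ξ : ∀ X Z {Y} k {φ : Formula (Var (X ++ Z) ∪ Var Y)} {ψ : Formula (Copies k Y)} →
    Ξ (pair k φ ψ) →
    Ξ (pair k (rename (regroup X Z) φ) (rename (inBlock Z k) ψ ∧̇ allEqual Z k))
  normal-Ξ X Z {Y} k {φ} {ψ} ξ (e , ps , q , r) =
    ξ (e′ ,
       ⊨-⋀⁺ e′ _ (allFin k) (λ {i} _ → rename⁺ (Sum.map₂ (i ,_)) (λ _ → refl) φ
         (rename⁻ (regroup X Z) (agree i) φ
           (rename⁻ (Sum.map₂ (i ,_)) (λ _ → refl) (rename (regroup X Z) φ)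
             (⊨-⋀⁻ e _ (allFin k) ps (∈-allFin i))))) ,
       rename⁺ inj₂ (λ _ → refl) ψ (rename⁻ (inBlock Z k) (λ _ → refl) ψ
         (rename⁻ inj₂ (λ _ → refl) (rename (inBlock Z k) ψ) q)))
    where
    e₂ : Env (Copies k (Z ++ Y))
    e₂ v = e (inj₂ v)
    z-equal : ∀ {i j} → i Fin.< j → ∀ {t} (z : Var Z t) → e₂ (i , ∈-++⁺ˡ z) ≡ e₂ (j , ∈-++⁺ˡ z)
    z-equal {i} {j} i<j = ⊨-equal⁻ e₂ Z (λ z → i , ∈-++⁺ˡ z) (λ z → j , ∈-++⁺ˡ z)
      (⊨-⋀<⁻ e₂ (rename⁻ inj₂ (λ _ → refl) (allEqual Z k) r) i<j)
    common : ∀ k (f : Fin k → Tuple Z) → (∀ {i j} → i Fin.< j → ∀ {t} (z : Var Z t) → f i z ≡ f j z) →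
      Σ[ c ∈ Tuple Z ] (∀ i {t} (z : Var Z t) → f i z ≡ c z)
    -- Without copies there is no value to read off, so nonemptiness of the sorts supplies one.
    common zero    f h = (λ {t} _ → nonempty t) , λ ()
    common (suc k) f h = f zero , λ { zero z → refl ; (suc i) z → sym (h {zero} {suc i} (s≤s z≤n) z) }
    z̄ = common k (λ i z → e₂ (i , ∈-++⁺ˡ z)) z-equal
    e′ : Env (Var (X ++ Z) ∪ Copies k Y)
    e′ (inj₁ v)       = [ (λ x → e (inj₁ x)) , proj₁ z̄ ]′ (∈-++⁻ X v)
    e′ (inj₂ (i , y)) = e₂ (i , ∈-++⁺ʳ Z y)
    agree : ∀ i {t} (v : (Var (X ++ Z) ∪ Var Y) t) →
      e (Sum.map₂ (i ,_) (regroup X Z v)) ≡ e′ (Sum.map₂ (i ,_) v)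
    agree i (inj₁ v) with ∈-++⁻ X v
    ... | inj₁ x = refl
    ... | inj₂ z = proj₂ z̄ i z
    agree i (inj₂ y) = refl

  ΞM-normal : Normal ΞM
  ΞM-normal X Z Y k φ ψ (ξ , s , u , eq) = normal-Ξ X Z k {φ} {ψ} ξ , s , ∈-++⁺ʳ Z u , normal-≃ Z k u {ψ} eq

  -- The threshold of two copies.

  ¬Many⇒2≤ : ∀ {s} k {P : Property s} {a} → ¬ Many k P → P a → 2 ℕ.≤ k
  ¬Many⇒2≤ 0             few p = ⊥-elim (few ((λ ()) , (λ ()) , λ { {()} }))
  ¬Many⇒2≤ 1             few p = ⊥-elim (few ((λ _ → _) , (λ _ → p) , λ { {zero} {zero} () }))
  ¬Many⇒2≤ (suc (suc _)) few p = s≤s (s≤s z≤n)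

  -- Dividing provides `ψ` along increasing `k`-tuples of indices only. To compare two terms of the
  -- sequence, their indices have to be extended to such a tuple.
  through : ∀ {k i j} → 2 ℕ.≤ k → i ℕ.< j →
    Σ[ m ∈ Fin k ] Σ[ n ∈ Fin k ] m Fin.< n ×
    (Σ[ ι ∈ (Fin k → ℕ) ] (∀ m n → m Fin.< n → ι m ℕ.< ι n) × ι m ≡ i × ι n ≡ j)
  through {suc (suc k)} {i} {j} (s≤s (s≤s _)) i<j = zero , suc zero , s≤s z≤n , ι , ι-mono , refl , refl
    where
    ι : Fin (suc (suc k)) → ℕ
    ι zero    = i
    -- Position 1 receives `j`, the later positions `j + 1`, `j + 2` and so on.
    ι (suc m) = Fin.toℕ m ℕ.+ j
    ι-mono : ∀ m n → m Fin.< n → ι m ℕ.< ι n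
    ι-mono zero    (suc n) _         = ℕₚ.<-≤-trans i<j (ℕₚ.m≤n+m j (Fin.toℕ n))
    ι-mono (suc m) (suc n) (s≤s m<n) = ℕₚ.+-monoˡ-< j m<n

  -- Finiteness by excluded middle.

  module _ (em : ExcludedMiddle (lsuc ℓ)) where

    by-contradiction : ∀ {A : Set (lsuc ℓ)} → ¬ ¬ A → A
    by-contradiction {A} h with em {A}
    ... | yes a = a
    ... | no ¬a = ⊥-elim (h ¬a)

    -- Excluded middle decides whether some element satisfies `P`. If one does, fewer than `n`
    -- others can, and the induction continues with these.
    ¬Many⇒Finite : ∀ {s} n {P : Property s} → ¬ Many n P → Finite P
    ¬Many⇒Finite zero    h = ⊥-elim (h ((λ ()) , (λ ()) , λ { {()} }))
    ¬Many⇒Finite {s} (suc n) {P} h with em {Σ (Carrier s) P}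
    ... | no ¬p = [] , λ a p → ⊥-elim (¬p (a , p))
    ... | yes (b , q) = let as , k = ¬Many⇒Finite n (h ∘ Many-∷ {P = P} b q) in b ∷ as , bound as k
      where
      bound : ∀ as → (∀ a → P a × ¬ a ≡ b → a ∈ as) → ∀ a → P a → a ∈ b ∷ as
      bound as k a p with em {a ≡ b}
      ... | yes eq = here eq
      ... | no a≢b = there (k a (p , a≢b))

    Finite-∃ : ∀ {s t} {P : Property s} {Q : Carrier s → Property t} →
      Finite P → (∀ b → Finite (Q b)) → Finite (λ a → Σ[ b ∈ Carrier s ] P b × Q b a)
    Finite-∃ (bs , h) k = concatMap (proj₁ ∘ k) bs ,
      λ a (b , p , q) → ∈-concatMap⁺ (proj₁ ∘ k) (Any.map (λ { refl → proj₂ (k b) a q }) (h b p))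

    -- Algebraicity

    IsParam : ∀ {Γ : Ctx} → SmallSet → Env Γ → Set (lsuc ℓ)
    IsParam {Γ} A e = ∀ {s} (v : Γ s) → ⟪ A ⟫ (s , e v)

    -- Formulas over `A` refer to indices, but only the values matter: parameters may be named by
    -- any context, and an index for each is read off from the proof that its value lies in `A`.
    acl-intro : ∀ {Γ : Ctx} {A s a} (φ : Formula (Γ ∪ ｛ s ｝)) (e : Env Γ) → IsParam {Γ} A e →
      Sol φ e a → Finite (Sol φ e) → acl A (s , a)
    acl-intro {Γ} {A} {s} {a} φ e h p F =
      rename ρ φ , rename⁺ ρ agree φ p ,
      proj₁ F , λ a′ q → proj₂ F a′ (rename⁻ ρ agree φ q)
      where
      ρ : Γ ∪ ｛ s ｝ ⊆ ｛ s ｝ ∪ Index A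
      ρ (inj₁ v) = inj₂ (proj₁ (h v))
      ρ (inj₂ v) = inj₁ v
      agree : ∀ {b t} (v : (Γ ∪ ｛ s ｝) t) →
        (_⊕_ {｛ s ｝} {Index A} (single b) (elem A)) (ρ v) ≡ (_▸_ {Γ} e b) v
      agree (inj₁ v) = proj₂ (h v)
      agree (inj₂ v) = refl

    -- A numerical bound replaces the list of solutions, since a bound can be stated inside a
    -- formula by `many`.
    record Algebraic (A : SmallSet) {s} (a : Carrier s) : Set (lsuc ℓ) where
      constructor algebraic
      field
        bound   : ℕ
        formula : Formula (Index A ∪ ｛ s ｝)
        holds   : Sol formula (elem A) a
        few     : ¬ Many bound (Sol formula (elem A))

    acl-elim : ∀ {A s a} → acl A (s , a) → Algebraic A a
    acl-elim {A} {s} {a} (χ , p , as , h) =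
      algebraic (suc (length as)) (rename Sum.swap χ) (rename⁺ Sum.swap agree χ p)
        (Finite⇒¬Many _ (as , λ a′ q → h a′ (rename⁻ Sum.swap {_▸_ {Index A} (elem A) a′} agree χ q)) refl)
      where
      agree : ∀ {b t} (v : (｛ s ｝ ∪ Index A) t) →
        (_▸_ {Index A} (elem A) b) (Sum.swap v) ≡ (_⊕_ {｛ s ｝} {Index A} (single b) (elem A)) v
      agree (inj₁ v) = refl
      agree (inj₂ v) = refl

    acl-mono : ∀ {A B} → ⟪ A ⟫ ⊆ ⟪ B ⟫ → acl A ⊆ acl B
    acl-mono {A} {B} h p = let algebraic n φ q f = acl-elim {A} p in
      acl-intro {A = B} φ (elem A) (λ v → h (v , refl)) q (¬Many⇒Finite n f)

    ⊆-acl : ∀ {A} → ⟪ A ⟫ ⊆ acl A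
    ⊆-acl {A} {s , a} (i , eq) =
      var (inj₁ refl) ≈̇ var (inj₂ i) , sym eq , [ elem A i ] , λ a′ eq′ → here eq′

    Finite-⊆ : ∀ {s} {P Q : Property s} → (∀ a → P a → Q a) → Finite Q → Finite P
    Finite-⊆ h (as , k) = as , λ a p → k a (h a p)

    -- If `P` has `n` members, the second clause fails and nothing is left. Adding the clause thus
    -- tames the instances of an algebraic formula at other parameters, where it may have infinitely
    -- many solutions.
    Finite-few : ∀ {s} n {P : Property s} → Finite (λ a → P a × ¬ Many n P)
    Finite-few n {P} with em {Many n P}
    ... | yes m = [] , λ _ (_ , ¬m) → ⊥-elim (¬m m)
    ... | no ¬m = Finite-⊆ (λ _ → proj₁) (¬Many⇒Finite n ¬m)

    point : ∀ {s} → Carrier s → SmallSet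
    point {s} a = small ｛ s ｝ (single a)

    -- Of the finitely many solutions of `θ`, only `b` is known to make `χ` algebraic. The clause
    -- that `χ` has fewer than `n` solutions bounds every instance, so the union over all solutions
    -- of `θ` is finite.
    acl-point : ∀ {F s t} {a : Carrier s} {b : Carrier t} → acl F (t , b) →
      acl (F ⋓ point b) (s , a) → acl F (s , a)
    acl-point {F} {s} {t} {a} {b} q p =
      let algebraic m θ θb θ-few = acl-elim {F} q
          algebraic n χ χa χ-few = acl-elim {F ⋓ point b} p
          e = elem F
          open-Sol = λ b′ → Sol χ (_▸_ {Index F} e b′)
      in acl-intro {Index F} {F} {s} {a}
           (∃̇ t (rename weaken θ ∧̇ rename swap χ ∧̇ ¬̇ rename weaken (many n χ))) e (λ v → v , refl)
           (b , rename⁺ weaken weaken-agree θ θb ,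
                rename⁺ swap swap-agree χ χa ,
                λ m → χ-few (many⁻ n χ (_▸_ {Index F} e b) (rename⁻ weaken weaken-agree (many n χ) m)))
           (Finite-⊆ (λ a′ (b′ , θb′ , χa′ , few) →
                b′ , rename⁻ weaken weaken-agree θ θb′ ,
                rename⁻ swap swap-agree χ χa′ ,
                λ m → few (rename⁺ weaken weaken-agree (many n χ) (many⁺ n χ (_▸_ {Index F} e b′) m)))
             (Finite-∃ (¬Many⇒Finite m θ-few) (λ b′ → Finite-few n {open-Sol b′})))
      where
      weaken : Index F ∪ ｛ t ｝ ⊆ (Index F ∪ ｛ s ｝) ∪ ｛ t ｝
      weaken = Sum.map₁ inj₁
      swap : (Index F ∪ ｛ t ｝) ∪ ｛ s ｝ ⊆ (Index F ∪ ｛ s ｝) ∪ ｛ t ｝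
      swap (inj₁ (inj₁ i)) = inj₁ (inj₁ i)
      swap (inj₁ (inj₂ v)) = inj₂ v
      swap (inj₂ v)        = inj₁ (inj₂ v)
      weaken-agree : ∀ {a b r} (v : (Index F ∪ ｛ t ｝) r) →
        (_▸_ {Index F ∪ ｛ s ｝} (_▸_ {Index F} (elem F) a) b) (weaken v) ≡ (_▸_ {Index F} (elem F) b) v
      weaken-agree (inj₁ _) = refl
      weaken-agree (inj₂ _) = refl
      swap-agree : ∀ {a b r} (v : ((Index F ∪ ｛ t ｝) ∪ ｛ s ｝) r) →
        (_▸_ {Index F ∪ ｛ s ｝} (_▸_ {Index F} (elem F) a) b) (swap v) ≡
        (_▸_ {Index F ∪ ｛ t ｝} (_▸_ {Index F} (elem F) b) a) v
      swap-agree (inj₁ (inj₁ _)) = refl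
      swap-agree (inj₁ (inj₂ _)) = refl
      swap-agree (inj₂ _)        = refl

    acl-tuple : ∀ X (e : Tuple X) F → (∀ {t} (v : Var X t) → acl F (t , e v)) → acl (F ⋓ entries e) ⊆ acl F
    acl-tuple [] e F h = acl-mono {F ⋓ entries e} {F} (λ { (inj₁ i , eq) → i , eq ; (inj₂ () , _) })
    acl-tuple (t ∷ X) e F h {s , a} p =
      acl-point {F} (h (here refl))
        (acl-tuple X (λ v → e (there v)) F′ (λ v → acl-mono {F} {F′} (λ (i , eq) → inj₁ i , eq) (h (there v)))
          (acl-mono {F ⋓ entries e} {F′ ⋓ entries (λ v → e (there v))}
            (λ { (inj₁ i , eq) → inj₁ (inj₁ i) , eq
               ; (inj₂ (here refl) , eq) → inj₁ (inj₂ refl) , eq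
               ; (inj₂ (there v) , eq) → inj₂ v , eq }) p))
      where
      F′ : SmallSet
      F′ = F ⋓ point (e (here refl))

    -- The witnessing formula uses only finitely many elements of `E`, and `acl-tuple` absorbs these
    -- one by one.
    acl-closed : ∀ {E F} → ⟪ E ⟫ ⊆ acl F → acl E ⊆ acl F
    acl-closed {E} {F} h {s , a} p =
      let algebraic n φ φa few = acl-elim {E} p
          finitePart X ρ φ′ sat⁺ sat⁻ = finPart {Index E} {｛ s ｝} {Index E ∪ ｛ s ｝} id φ
          e : Env (Var X)
          e = λ v → elem E (ρ v)
          agree : ∀ a′ {t} (v : (Var X ∪ ｛ s ｝) t) →
            (_▸_ {Index E} (elem E) a′) (Sum.map₁ ρ v) ≡ (_▸_ {Var X} e a′) v
          agree = λ { a′ (inj₁ _) → refl ; a′ (inj₂ _) → refl }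
      in acl-tuple X e F (λ v → h (ρ v , refl))
           (acl-intro {Var X} {F ⋓ entries e} φ′ e (λ v → inj₂ v , refl)
             (⊨-cong (agree a) φ′ (sat⁺ (_▸_ {Index E} (elem E) a) φa))
             (Finite-⊆ (λ a′ q → sat⁻ (_▸_ {Index E} (elem E) a′) (⊨-cong (λ v → sym (agree a′ v)) φ′ q))
               (¬Many⇒Finite n few)))

    -- Conjugates of a nonalgebraic element.

    infix 4 _≼[_]_
    _≼[_]_ : ∀ {s} → Carrier s → SmallSet → Carrier s → Set (lsuc ℓ)
    a ≼[ D ] b = ∀ χ → ⊨[ D ] χ ⟨ single a ⟩ → ⊨[ D ] χ ⟨ single b ⟩

    module _ (saturated : Saturated) {D : SmallSet} {s} {a : Carrier s} (nonalg : ¬ acl D (s , a)) where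

      -- Saturation is applied to the type of `a` over `D` together with the inequations against
      -- `as`. If this were not finitely satisfiable, some formula true of `a` would have all its
      -- solutions in `as`, making `a` algebraic.
      fresh : ∀ as → Σ[ b ∈ Carrier s ] a ≼[ D ] b × b ∉ as
      fresh as =
        let b , h = saturated D′ s p finsat
        in b ,
           (λ χ χa → rename⁻ (Sum.map₂ inj₁) (λ { (inj₁ refl) → refl ; (inj₂ _) → refl }) χ
             (h (rename (Sum.map₂ inj₁) χ)
               (χ , χa , λ b′ q _ →
                 rename⁺ (Sum.map₂ inj₁) (λ { (inj₁ refl) → refl ; (inj₂ _) → refl }) χ q))) ,
           λ b∈ → h (distinct (Any.index b∈))
             (⊤̇ , _ , λ b′ _ b′∉ eq → b′∉ (subst (_∈ as) (sym eq) (∈-lookup (Any.index b∈))))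
             (lookup-index b∈)
        where
        D′ : SmallSet
        D′ = D ⋓ small (λ t → s ≡ t × Fin (length as)) (λ { (refl , i) → lookup as i })
        -- The type consists of everything that follows, outside `as`, from a single formula true of
        -- `a`. This treats the formulas over `D` and the inequations uniformly, and any finite part
        -- of it follows from one conjunction.
        p : FormulaOver D′ ｛ s ｝ → Set (lsuc ℓ)
        p χ′ = Σ[ χ ∈ FormulaOver D ｛ s ｝ ] (⊨[ D ] χ ⟨ single a ⟩) ×
          (∀ b → ⊨[ D ] χ ⟨ single b ⟩ → b ∉ as → ⊨[ D′ ] χ′ ⟨ single b ⟩)
        distinct : Fin (length as) → FormulaOver D′ ｛ s ｝
        distinct i = ¬̇ (var (inj₁ refl) ≈̇ var (inj₂ (inj₂ (refl , i))))
        common : ∀ χs → All p χs → Σ[ χ ∈ FormulaOver D ｛ s ｝ ] (⊨[ D ] χ ⟨ single a ⟩) ×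
          (∀ b → ⊨[ D ] χ ⟨ single b ⟩ → b ∉ as → All (λ χ′ → ⊨[ D′ ] χ′ ⟨ single b ⟩) χs)
        common [] [] = ⊤̇ , _ , λ _ _ _ → []
        common (_ ∷ χs) ((χ , χa , h) ∷ ps) = let θ , θa , k = common χs ps in
          χ ∧̇ θ , (χa , θa) , λ b (q , r) b∉ → h b q b∉ ∷ k b r b∉
        finsat : ∀ χs → All p χs → ∃[ b ] All (λ χ → ⊨[ D′ ] χ ⟨ single b ⟩) χs
        finsat χs ps = let χ , χa , h = common χs ps in by-contradiction λ none →
          nonalg (χ , χa , as , λ b q → by-contradiction λ b∉ → none (b , h b q b∉))

      initial : ℕ → List (Carrier s)
      initial zero    = []
      initial (suc n) = proj₁ (fresh (initial n)) ∷ initial n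

      conjugate : ℕ → Carrier s
      conjugate n = proj₁ (fresh (initial n))

      conjugate-≼ : ∀ n → a ≼[ D ] conjugate n
      conjugate-≼ n = proj₁ (proj₂ (fresh (initial n)))

      -- The relation `<′` grows at its upper end, just as `initial` does.
      conjugate-∈ : ∀ {i j} → i ℕ.<′ j → conjugate i ∈ initial j
      conjugate-∈ ℕ.<′-base       = here refl
      conjugate-∈ (ℕ.<′-step i<j) = there (conjugate-∈ i<j)

      conjugate-distinct : ∀ {i j} → i ℕ.< j → conjugate i ≢ conjugate j
      conjugate-distinct {i} {j} i<j eq =
        proj₂ (proj₂ (fresh (initial j))) (subst (_∈ initial j) eq (conjugate-∈ (ℕₚ.<⇒<′ i<j)))

    -- Division by pairs in Ξ_M

    module _ {X Y k s} {φ : Formula (Var X ∪ Var Y)} {ψ : Formula (Copies k Y)} (u : Var Y s)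
             (ξ : Ξ (pair k φ ψ)) (eq : ψ ≃ allDiffer k u) where

      -- The entry `b u` is itself a solution, while `few-replacements` allows fewer than `k`.
      solved⇒2≤k : ∀ (a : Tuple X) (b : Tuple Y) → ⊨ φ ⟨ _⊕_ {Var X} {Var Y} a b ⟩ → 2 ℕ.≤ k
      solved⇒2≤k a b p = ¬Many⇒2≤ k {λ c → ⊨ φ ⟨ _⊕_ {Var X} {Var Y} a (replace u b c) ⟩} {b u}
        (few-replacements {φ = φ} {ψ} u ξ eq a b)
        (⊨-cong (λ { (inj₁ _) → refl ; (inj₂ v) → sym (replace-id u b v) }) φ p)

      -- With `a` and the other entries of `b` as parameters, `φ` becomes a formula about the entry
      -- at `u` alone, and `few-replacements` bounds its solutions.
      solution-algebraic : ∀ {E} (a : Tuple X) (b : Tuple Y) → ⟪ entries a ⟫ ⊆ ⟪ E ⟫ → ⟪ rest u b ⟫ ⊆ ⟪ E ⟫ →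
        ⊨ φ ⟨ _⊕_ {Var X} {Var Y} a b ⟩ → acl E (s , b u)
      solution-algebraic {E} a b a∈E r∈E p =
        acl-intro {Var X ∪ Rest u} (rename ρ φ) e
          (λ { (inj₁ x) → a∈E (x , refl) ; (inj₂ r) → r∈E (r , refl) })
          (rename⁺ ρ agree φ (⊨-cong (λ { (inj₁ _) → refl ; (inj₂ v) → sym (replace-id u b v) }) φ p))
          (Finite-⊆ (λ c → rename⁻ ρ agree φ) (¬Many⇒Finite k (few-replacements {φ = φ} {ψ} u ξ eq a b)))
        where
        e : Env (Var X ∪ Rest u)
        e (inj₁ x) = a x
        e (inj₂ r) = elem (rest u b) r
        ρ : Var X ∪ Var Y ⊆ (Var X ∪ Rest u) ∪ ｛ s ｝
        ρ (inj₁ x) = inj₁ (inj₁ x)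
        ρ (inj₂ v) = Sum.map₁ inj₂ (split u v)
        agree : ∀ {c t} (v : (Var X ∪ Var Y) t) →
          (_▸_ {Var X ∪ Rest u} e c) (ρ v) ≡ (_⊕_ {Var X} {Var Y} a (replace u b c)) v
        agree (inj₁ x) = refl
        agree (inj₂ v) with split u v
        ... | inj₁ _ = refl
        ... | inj₂ _ = refl

      module _ (2≤k : 2 ℕ.≤ k) (bs : ℕ → Tuple Y)
               (h : ∀ (ι : Fin k → ℕ) → (∀ i j → i Fin.< j → ι i ℕ.< ι j) →
                  ⊨ ψ ⟨ (λ (i , y) → bs (ι i) y) ⟩) where

        pairwise : ∀ {i j} → i ℕ.< j → bs i u ≢ bs j u × (∀ {t} (v : Var Y t) → Off u v → bs i v ≡ bs j v)
        pairwise {i} {j} i<j with through 2≤k i<j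
        ... | m , n , m<n , ι , ι-mono , refl , refl = ⊨-differ⁻ copies u (m ,_) (n ,_)
            (⊨-⋀<⁻ copies (⊨-≃ copies {ψ} {allDiffer k u} eq (h ι ι-mono)) m<n)
          where
          copies : Env (Copies k Y)
          copies (m , v) = bs (ι m) v

      -- A formula witnessing algebraicity, together with its bound, passes to the dividing sequence
      -- by sameness of types. The terms of the sequence share all entries but the one at `u`, where
      -- they are pairwise distinct, so one formula would exceed its own bound.
      divides⇒nonalgebraic : ∀ {C} (b : Tuple Y) → 2 ℕ.≤ k → Divides (pair k φ ψ) b C →
        ¬ acl (C ⋓ rest u b) (s , b u)
      divides⇒nonalgebraic {C} b 2≤k (bs , typ , h) p =
        let algebraic n χ χb few = acl-elim {C ⋓ rest u b} p
            θ : FormulaOver C (Var Y)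
            -- The entries shared by the sequence may differ from those of `b`, so the bound has to
            -- be carried along by the type.
            θ = rename σ χ ∧̇ ¬̇ rename (σ ∘ inj₁) (many n χ)
            realised : ∀ i → ⊨[ C ] θ ⟨ bs i ⟩
            realised i = typ i θ (rename⁺ σ (agree b) χ χb ,
              λ m → few (many⁻ n χ (params b) (rename⁻ (σ ∘ inj₁) (agree b ∘ inj₁) (many n χ) m)))
            solutions : ∀ i → Sol χ (params (bs 0)) (bs i u)
            solutions i = ⊨-cong
              (λ { (inj₁ (inj₁ _)) → refl ; (inj₁ (inj₂ (v , o))) → rest-constant i v o ; (inj₂ _) → refl }) χ
              (rename⁻ σ (agree (bs i)) χ (proj₁ (realised i)))
        in proj₂ (realised 0) (rename⁺ (σ ∘ inj₁) (agree (bs 0) ∘ inj₁) (many n χ)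
             (many⁺ n χ (params (bs 0))
               (ℕ-Many {P = Sol χ (params (bs 0))} (λ i → bs i u) solutions
                 (λ i<j → proj₁ (pairwise 2≤k bs h i<j)) n)))
        where
        params : (b′ : Tuple Y) → Env (Index C ∪ Rest u)
        params b′ = elem (C ⋓ rest u b′)
        σ : (Index C ∪ Rest u) ∪ ｛ s ｝ ⊆ Var Y ∪ Index C
        σ (inj₁ (inj₁ i))       = inj₂ i
        σ (inj₁ (inj₂ (v , _))) = inj₁ v
        σ (inj₂ refl)           = inj₁ u
        agree : ∀ (b′ : Tuple Y) {t} (v : ((Index C ∪ Rest u) ∪ ｛ s ｝) t) →
          (_⊕_ {Var Y} {Index C} b′ (elem C)) (σ v) ≡ (_▸_ {Index C ∪ Rest u} (params b′) (b′ u)) v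
        agree b′ (inj₁ (inj₁ _)) = refl
        agree b′ (inj₁ (inj₂ _)) = refl
        agree b′ (inj₂ refl)     = refl
        rest-constant : ∀ i {t} (v : Var Y t) → Off u v → bs i v ≡ bs 0 v
        rest-constant zero    v o = refl
        rest-constant (suc i) v o = sym (proj₂ (pairwise 2≤k bs h (s≤s z≤n)) v o)

      -- Conjugates of `b u` over `C ⋓ rest u b` can be substituted for it without changing the type
      -- of `b` over `C`; pairwise distinct ones make `ψ` true.
      nonalgebraic⇒divides : Saturated → ∀ {C} (b : Tuple Y) → ¬ acl (C ⋓ rest u b) (s , b u) →
        Divides (pair k φ ψ) b C
      nonalgebraic⇒divides saturated {C} b nonalg = bs , typ , λ ι mono →
        let copies : Env (Copies k Y)
            copies = λ (i , v) → bs (ι i) v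
        in ⊨-≃ copies {allDiffer k u} {ψ} (mk⇔ (from eq) (to eq))
             (⊨-⋀<⁺ copies λ {i} {j} i<j → ⊨-differ⁺ copies u (i ,_) (j ,_)
               ( (λ q → conjugate-distinct saturated nonalg (mono i j i<j)
                   (trans (sym (replace-same u b _)) (trans q (replace-same u b _))))
               , λ v o → trans (replace-other u b _ v o) (sym (replace-other u b _ v o))))
        where
        bs : ℕ → Tuple Y
        bs i = replace u b (conjugate saturated nonalg i)
        τ : Var Y ∪ Index C ⊆ ｛ s ｝ ∪ (Index C ∪ Rest u)
        τ (inj₁ v) = [ (λ r → inj₂ (inj₂ r)) , inj₁ ]′ (split u v)
        τ (inj₂ i) = inj₂ (inj₁ i)
        agree : ∀ {c t} (v : (Var Y ∪ Index C) t) →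
          (_⊕_ {｛ s ｝} {Index C ∪ Rest u} (single c) (elem (C ⋓ rest u b))) (τ v) ≡
          (_⊕_ {Var Y} {Index C} (replace u b c) (elem C)) v
        agree (inj₁ v) with split u v
        ... | inj₁ _ = refl
        ... | inj₂ _ = refl
        agree (inj₂ i) = refl
        typ : ∀ i χ → tp b C χ → tp (bs i) C χ
        typ i χ p = rename⁻ τ agree χ (conjugate-≼ saturated nonalg i (rename τ χ)
          (rename⁺ τ agree χ (⊨-cong (λ { (inj₁ v) → sym (replace-id u b v) ; (inj₂ _) → refl }) χ p)))

    -- Independence in terms of algebraic closure.

    AclCondition : SmallSet → SmallSet → SmallSet → Set (lsuc ℓ)
    AclCondition A C B = ∀ D → ⟪ C ⟫ ⊆ ⟪ D ⟫ → ⟪ D ⟫ ⊆ ⟪ B ⋓ C ⟫ → (acl (A ⋓ D) ∩ ⟪ B ⟫) ⊆ acl D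

    -- Let `D` be `C` with the entries of `b` other than `b u`. A formula of the pair satisfied by
    -- `a` makes `b u` algebraic over `A ⋓ D`; the condition pulls it into `acl D`, which dividing
    -- excludes.
    aclCondition⇒⊥ : ∀ {A B C} → AclCondition A C B → ⊥[ ΞM ] A C B
    aclCondition⇒⊥ {A} {B} {C} h (X , a , a∈A , Y , k , φ , ψ , β , (ξ , s , u , eq) , p , divides) =
      divides⇒nonalgebraic {φ = φ} {ψ} u ξ eq {C} b (solved⇒2≤k {φ = φ} {ψ} u ξ eq a b φab) divides
        (contained (β u) refl)
      where
      b : Tuple Y
      b v = elem (B ⋓ C) (β v)
      D : SmallSet
      D = C ⋓ rest u b
      φab : ⊨ φ ⟨ _⊕_ {Var X} {Var Y} a b ⟩
      φab = rename⁻ (Sum.map₂ β) (λ { (inj₁ _) → refl ; (inj₂ _) → refl }) φ p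
      contained : (i : Index (B ⋓ C) s) → elem (B ⋓ C) i ≡ b u → acl D (s , b u)
      contained (inj₁ i) eq′ = h D (λ (i , q) → inj₁ i , q)
        (λ { (inj₁ i , q) → inj₂ i , q ; (inj₂ (v , _) , q) → β v , q })
        (solution-algebraic {φ = φ} {ψ} u ξ eq {A ⋓ D} a b
          (λ x → let i , q = a∈A x in inj₁ i , q) (λ (r , q) → inj₂ (inj₂ r) , q) φab
        , i , eq′)
      -- Here `b u` comes from `C`; the condition speaks of elements of `B` only, but membership in
      -- `D` is immediate.
      contained (inj₂ i) eq′ = ⊆-acl {D} (inj₁ i , eq′)

    -- Suppose `c` is algebraic over `A ⋓ D` but not over `D`. The witnessing formula, cut down to
    -- finitely many parameters and with its bound built in, belongs to a pair in `ΞM`; it holds of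
    -- a tuple from `A` and divides because `c` has infinitely many conjugates over `D`.
    ⊥⇒aclCondition : Saturated → ∀ {A B C} → ⊥[ ΞM ] A C B → AclCondition A C B
    ⊥⇒aclCondition saturated {A} {B} {C} indep D C⊆D D⊆BC {s , c} (p , c∈B) with acl-elim {A ⋓ D} p
    -- Having fewer than zero solutions is impossible, so the bound is a successor, as
    -- `fewSolutions∈Ξ` requires.
    ... | algebraic zero    χ χc few = ⊥-elim (few ((λ ()) , (λ ()) , λ { {()} }))
    ... | algebraic (suc n) χ χc few = by-contradiction λ nonalg →
      indep (X , a , (λ (x , q) → left x , q) , Y , suc n , φ , allDiffer (suc n) u , β ,
        (ξ , s , u , mk⇔ id id) ,
        rename⁺ (Sum.map₂ β) (λ { (inj₁ _) → refl ; (inj₂ _) → refl }) φ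
          (⊨-fewSolutions⁺ (suc n) formula a b
            (⊨-cong (agree (sym (proj₂ c∈B))) formula (sat⁺ (elem (A ⋓ D)) c χc))
            (λ m → few (Many-map {P = Sol formula params} (λ c′ q → sat⁻ (elem (A ⋓ D)) c′
              (⊨-cong (λ v → sym (agree refl v)) formula q)) m))) ,
        nonalgebraic⇒divides {φ = φ} {allDiffer (suc n) u} u ξ (mk⇔ id id) saturated b
          (λ q → nonalg (subst (λ d → acl D (s , d)) (proj₂ c∈B) (acl-mono {C ⋓ rest u b} {D} rest⊆D q))))
      where
      open FiniteSupport (support {Index A} {Index D} χ)
      Y = s ∷ V
      u : Var Y s
      u = here refl
      a : Tuple X
      a x = elem A (left x)
      β : Var Y ⊆ Index (B ⋓ C)
      β (here refl) = inj₁ (proj₁ c∈B)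
      -- The remaining parameters lie in `D` but have to be indexed in `B ⋓ C`; the two namings
      -- agree up to the equation supplied by `D⊆BC`, which `agree` transports.
      β (there v)   = proj₁ (D⊆BC (right v , refl))
      b : Tuple Y
      b v = elem (B ⋓ C) (β v)
      φ : Formula (Var X ∪ Var Y)
      φ = fewSolutions (suc n) formula
      ξ : Ξ (pair (suc n) φ (allDiffer (suc n) u))
      ξ = fewSolutions∈Ξ n formula
      params : Env (Var X ∪ Var V)
      params = tail (suc n) formula a b
      agree : ∀ {c c′ t} → c ≡ c′ → (v : ((Var X ∪ Var V) ∪ ｛ s ｝) t) →
        (_▸_ {Var X ∪ Var V} (restrict (elem (A ⋓ D))) c) v ≡ (_▸_ {Var X ∪ Var V} params c′) v
      agree _    (inj₁ (inj₁ _)) = refl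
      agree _    (inj₁ (inj₂ v)) = sym (proj₂ (D⊆BC (right v , refl)))
      agree refl (inj₂ _)        = refl
      rest⊆D : ⟪ C ⋓ rest u b ⟫ ⊆ ⟪ D ⟫
      rest⊆D (inj₁ i , q)             = C⊆D (i , q)
      rest⊆D (inj₂ (there v , _) , q) = right v , trans (sym (proj₂ (D⊆BC (right v , refl)))) q

    -- Transitivity.

    ΞM-transitive : Saturated → Transitive ΞM
    ΞM-transitive saturated (pair {X} {Y} k φ ψ) (ξ , s , u , eq) b C D D⊆C indep divides
      with em {acl (C ⋓ rest u b) (s , b u)} | 2 ℕ.≤? k
    ... | no nonalg | _ = nonalgebraic⇒divides {φ = φ} {ψ} u ξ eq saturated {C} b nonalg
    -- The acl condition for the assumed independence, taken at the set `E`, moves `b u` from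
    -- `acl (C ⋓ E)` into `acl E`. This contradicts dividing over `D`.
    ... | yes alg | yes 2≤k = ⊥-elim (divides⇒nonalgebraic {φ = φ} {ψ} u ξ eq {D} b 2≤k divides
            (⊥⇒aclCondition saturated indep E (λ (i , q) → inj₁ i , q)
              (λ { (inj₁ i , q) → inj₂ i , q ; (inj₂ (v , _) , q) → inj₁ v , q })
              ( acl-mono {C ⋓ rest u b} {C ⋓ E}
                  (λ { (inj₁ i , q) → inj₁ i , q ; (inj₂ r , q) → inj₂ (inj₂ r) , q }) alg
              , u , refl)))
      where
      E : SmallSet
      E = D ⋓ rest u b
    -- With fewer than two copies `ψ` amounts to an empty conjunction, so the constant sequence
    -- witnesses dividing.
    ... | yes _ | no 2≰k = (λ _ → b) , (λ _ _ p → p) , λ ι _ →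
            let copies : Env (Copies k Y)
                copies = λ (_ , v) → b v
            in ⊨-≃ copies {allDiffer k u} {ψ} (mk⇔ (from eq) (to eq))
                 (⊨-⋀<⁺ copies λ {i} {j} i<j → ⊥-elim (2≰k
                   (ℕₚ.≤-trans (s≤s (ℕₚ.≤-trans (s≤s z≤n) i<j)) (toℕ<n j))))

    -- Comparison with M-dividing and the starred relations.

    ⊥M⇒⊥ : ∀ {A B C} → ⊥M A C B → ⊥[ ΞM ] A C B
    ⊥M⇒⊥ {A} {B} {C} indep = aclCondition⇒⊥ λ D C⊆D D⊆BC (p , (i , q)) →
      proj₁ (indep D C⊆D (λ d → ⊆-acl {B ⋓ C} (D⊆BC d))) (p , ⊆-acl {B ⋓ D} (inj₁ i , q))

    -- Total on the natural numbers, so that `closure` can be indexed by formulas and numbers alone.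
    -- Proofs of finiteness live in `Set (lsuc ℓ)`, too large for the index of a `SmallSet`.
    nth : ∀ {s} → List (Carrier s) → ℕ → Carrier s
    nth []       n       = nonempty _
    nth (a ∷ _)  zero    = a
    nth (_ ∷ as) (suc n) = nth as n

    nth-∈ : ∀ {s} {a : Carrier s} {as} → a ∈ as → Σ[ n ∈ ℕ ] nth as n ≡ a
    nth-∈ (here eq) = zero , sym eq
    nth-∈ (there p) = let n , eq = nth-∈ p in suc n , eq

    solutions : ∀ {E s} → FormulaOver E ｛ s ｝ → List (Carrier s)
    solutions {E} χ with em {Finite (λ a → ⊨[ E ] χ ⟨ single a ⟩)}
    ... | yes (as , _) = as
    ... | no _         = []

    ∈-solutions : ∀ {E s a} (χ : FormulaOver E ｛ s ｝) → Finite (λ a → ⊨[ E ] χ ⟨ single a ⟩) →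
      ⊨[ E ] χ ⟨ single a ⟩ → a ∈ solutions {E} χ
    ∈-solutions {E} χ F p with em {Finite (λ a → ⊨[ E ] χ ⟨ single a ⟩)}
    ... | yes (_ , h) = h _ p
    ... | no infinite = ⊥-elim (infinite F)

    -- Contains acl E, and possibly the arbitrary elements by which nth fills
    -- up the finite solution sets.
    closure : SmallSet → SmallSet
    closure E = small (λ s → FormulaOver E ｛ s ｝ × ℕ) (λ (χ , n) → nth (solutions {E} χ) n)

    acl⊆closure : ∀ {E} → acl E ⊆ ⟪ closure E ⟫
    acl⊆closure {E} (χ , p , F) = let n , eq = nth-∈ (∈-solutions {E} χ F p) in (χ , n) , eq

    -- Once the right-hand set covers `acl (B ⋓ C)`, every `C′` of M-dividing is an admissible `D`,
    -- and `acl (B ⋓ C′)` lies inside that set. Surplus elements of `closure` do no harm, as only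
    -- inclusions into it are used. The reverse inclusion is monotonicity.
    ⊥-closure⇒⊥M : Saturated → ∀ {A B C} → ⊥[ ΞM ] A C (closure (B ⋓ C)) → ⊥M A C B
    ⊥-closure⇒⊥M saturated {A} {B} {C} indep C′ C⊆C′ C′⊆acl =
      (λ (p , q) → ⊥⇒aclCondition saturated indep C′ C⊆C′
        (λ c → let i , eq = acl⊆closure {B ⋓ C} (C′⊆acl c) in inj₁ i , eq)
        (p , acl⊆closure {B ⋓ C} (acl-closed {B ⋓ C′} {B ⋓ C}
          (λ { (inj₁ i , eq) → ⊆-acl {B ⋓ C} (inj₁ i , eq) ; (inj₂ i , eq) → C′⊆acl (i , eq) }) q))) ,
      (λ p → acl-mono {C′} {A ⋓ C′} (λ (i , eq) → inj₂ i , eq) p ,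
             acl-mono {C′} {B ⋓ C′} (λ (i , eq) → inj₂ i , eq) p)

    ⊥M*⇔⊥* : Saturated → ∀ A B C → (⊥M *) A C B ⇔ (⊥[ ΞM ] *) A C B
    ⊥M*⇔⊥* saturated A B C = mk⇔ forth back
      where
      forth : (⊥M *) A C B → (⊥[ ΞM ] *) A C B
      forth indep B̂ B⊆B̂ = let A′ , A′≡A , r = indep B̂ B⊆B̂ in A′ , A′≡A , ⊥M⇒⊥ r
      back : (⊥[ ΞM ] *) A C B → (⊥M *) A C B
      back indep B̂ B⊆B̂ =
        -- The starred relation allows any superset of `B`, hence also this enlargement of `B̂`; the
        -- conjugacy of `A′` and `A` is over `B ⋓ C` in either case.
        let A′ , A′≡A , r = indep (closure (B̂ ⋓ C)) λ b → let i , eq = B⊆B̂ b in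
              acl⊆closure {B̂ ⋓ C} (⊆-acl {B̂ ⋓ C} (inj₁ i , eq))
        in A′ , A′≡A , ⊥-closure⇒⊥M saturated r

proposition2p36 : ∀ {ℓ} → ExcludedMiddle (lsuc ℓ) →
    (L : Signature ℓ) (T : Theory L) → Consistent T → Complete T →
    (M : Structure L) → Model T M → BigModel.IsBig M →
    let open BigModel M in
    (∀ A B C → ⊥[ ΞM ] A C B ⇔
      (∀ D → ⟪ C ⟫ ⊆ ⟪ D ⟫ → ⟪ D ⟫ ⊆ ⟪ B ⋓ C ⟫ → (acl (A ⋓ D) ∩ ⟪ B ⟫) ⊆ acl D)) ×
    (Transitive ΞM × Normal ΞM) ×
    (∀ A B C → ⊥M A C B → ⊥[ ΞM ] A C B) ×
    ((∀ A B C → ⊥þ A C B ⇔ (⊥M *) A C B) × (∀ A B C → (⊥M *) A C B ⇔ (⊥[ ΞM ] *) A C B))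
proposition2p36 em L T _ _ M _ (saturated , _) =
  (λ A B C → mk⇔ (⊥⇒aclCondition M em saturated) (aclCondition⇒⊥ M em)) ,
  (ΞM-transitive M em saturated , ΞM-normal M) ,
  (λ A B C → ⊥M⇒⊥ M em) ,
  (λ A B C → mk⇔ id id) ,
  ⊥M*⇔⊥* M em saturated
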